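{- Let $s\ge 1$ and $d\ge 1$ be integers. There exists an adaptive one-sided error tester for the property "$s$-binary rank at most $d$" of $n\times m$ $(0,1)$-matrices that makes $O\!\left(d\binom{d}{\le s}2^d/\epsilon\right)=\tilde O\!\left(\binom{d}{\le s}2^d/\epsilon\right)$ queries. The same query bound is achievable by an adaptive one-sided error tester for the property "$s$-binary rank exactly $d$".
   Context: For a $(0,1)$-matrix $M$ of size $n\times m$, $M[i,j]$ denotes its $(i,j)$ entry and $[n]=\{1,\dots,n\}$. The $s$-binary rank ${\rm br}_s(M)$ is the minimal integer $d\ge 0$ such that there exist $d$ sets (rectangles) $I_k\times J_k$ with $I_k\subseteq[n]$, $J_k\subseteq[m]$, $k\in[d]$, with $M[i,j]=1$ for all $(i,j)\in I_k\times J_k$ and all $k$, and such that every $(i,j)$ with $M[i,j]=1$ lies in at least one and at most $s$ of the rectangles. $\binom{d}{\le s}=\sum_{i=0}^{s}\binom{d}{i}$. A matrix $M$ is $\epsilon$-far from a property if more than an $\epsilon$-fraction of its $nm$ entries must be modified to obtain a matrix with the property. A tester receives $0<\epsilon<1$, $d,s,n,m$ and query access to the entries of $M$; if $M$ has the property it accepts with probability at least $2/3$, and if $M$ is $\epsilon$-far from the property it rejects with probability at least $2/3$. It is one-sided if it accepts matrices with the property with probability $1$. It is adaptive if queries may depend on previous answers. $\tilde O$ hides factors polylogarithmic in $\binom{d}{\le s}2^d$ and $1/\epsilon$. -}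

module Defs where

open import Algebra.Definitions.RawMonoid using (sum)
open import Data.Bool.Base using (Bool; true; false; if_then_else_)
open import Data.Bool.Properties using () renaming (_≟_ to _≟ᵇ_)
open import Data.Fin.Base using (Fin; toℕ)
open import Data.Fin.Subset using (Subset; _∈_)
open import Data.Fin.Subset.Properties using (_∈?_)
open import Data.Integer.Base using (+_; ∣_∣)
open import Data.Nat.Base as ℕ using (ℕ; suc; NonZero; _^_; _⊔_)
open import Data.Nat.Combinatorics using (_C_)
open import Data.Nat.Logarithm using (⌈log₂_⌉)
open import Data.Product.Base using (_×_; ∃-syntax)
open import Data.Rational.Base as ℚ
  using (ℚ; 0ℚ; 1ℚ; Positive; ceiling; 1/_; _÷_; _/_; _*_; _<_; _≤_)
open import Data.Rational.Properties using (pos⇒nonZero)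
open import Data.Vec.Functional using (Vector; foldr)
open import Relation.Binary.PropositionalEquality.Core using (_≡_)
open import Relation.Nullary.Decidable.Core using (Dec; does; _×-dec_)

fromℕ : ℕ → ℚ
fromℕ k = + k / 1

∑ : ∀ {n} → Vector ℕ n → ℕ
∑ = sum ℕ.+-0-rawMonoid

∑ℚ : ∀ {n} → Vector ℚ n → ℚ
∑ℚ = sum ℚ.+-0-rawMonoid

maximum : ∀ {n} → Vector ℕ n → ℕ
maximum = foldr _⊔_ 0

------------------------------------------------------------------------
-- Binary rank

Matrix : ℕ → ℕ → Set
Matrix n m = Fin n → Fin m → Bool

record Rectangle (n m : ℕ) : Set where
  constructor _⊠_
  field
    rows : Subset n
    cols : Subset m

open Rectangle public

_,_∈ᴿ_ : ∀ {n m} → Fin n → Fin m → Rectangle n m → Set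
i , j ∈ᴿ R = i ∈ rows R × j ∈ cols R

_,_∈ᴿ?_ : ∀ {n m} (i : Fin n) (j : Fin m) (R : Rectangle n m) → Dec (i , j ∈ᴿ R)
i , j ∈ᴿ? R = (i ∈? rows R) ×-dec (j ∈? cols R)

multiplicity : ∀ {n m d} → Vector (Rectangle n m) d → Fin n → Fin m → ℕ
multiplicity Rs i j = ∑ λ k → if does (i , j ∈ᴿ? Rs k) then 1 else 0

record IsCover {n m d} (s : ℕ) (M : Matrix n m) (Rs : Vector (Rectangle n m) d) : Set where
  field
    monochromatic : ∀ k i j → i , j ∈ᴿ Rs k → M i j ≡ true
    covered       : ∀ i j → M i j ≡ true → 1 ℕ.≤ multiplicity Rs i j
    at-most       : ∀ i j → M i j ≡ true → multiplicity Rs i j ℕ.≤ s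

Coverable : ∀ {n m} → ℕ → Matrix n m → ℕ → Set
Coverable {n} {m} s M d = ∃[ Rs ] IsCover {n} {m} {d} s M Rs

-- br_s(M) = r, as a relation between M and r.
record IsBinaryRank {n m} (s : ℕ) (M : Matrix n m) (r : ℕ) : Set where
  field
    coverable : Coverable s M r
    minimal   : ∀ d → Coverable s M d → r ℕ.≤ d

Property : Set₁
Property = ∀ {n m} → Matrix n m → Set

BinaryRankAtMost : (s d : ℕ) → Property
BinaryRankAtMost s d M = ∃[ r ] (IsBinaryRank s M r × r ℕ.≤ d)

BinaryRankExactly : (s d : ℕ) → Property
BinaryRankExactly s d M = IsBinaryRank s M d

------------------------------------------------------------------------
-- Property testing

distance : ∀ {n m} → Matrix n m → Matrix n m → ℕ
distance M N = ∑ λ i → ∑ λ j → if does (M i j ≟ᵇ N i j) then 0 else 1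

Far : ℚ → Property → ∀ {n m} → Matrix n m → Set
Far ε P {n} {m} M =
  ∀ (N : Matrix n m) → P N → ε * fromℕ (n ℕ.* m) < fromℕ (distance M N)

data Verdict : Set where
  accept reject : Verdict

-- Adaptive randomised query algorithms, as decision trees.
data Algorithm (n m : ℕ) : Set where
  output : Verdict → Algorithm n m
  query  : Fin n → Fin m → (Bool → Algorithm n m) → Algorithm n m
  -- Continue with a uniformly random element of Fin k.
  random : (k : ℕ) .{{_ : NonZero k}} → (Fin k → Algorithm n m) → Algorithm n m

indicator : Verdict → Verdict → ℚ
indicator accept accept = 1ℚ
indicator accept reject = 0ℚ
indicator reject accept = 0ℚ
indicator reject reject = 1ℚ

-- Pr v A M is the probability that A outputs v on M.
Pr : ∀ {n m} → Verdict → Algorithm n m → Matrix n m → ℚ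
Pr v (output w)    M = indicator v w
Pr v (query i j A) M = Pr v (A (M i j)) M
Pr v (random k A)  M = (+ 1 / k) * ∑ℚ λ x → Pr v (A x) M

-- The number of queries made on M, in the worst case over the random choices.
queries : ∀ {n m} → Algorithm n m → Matrix n m → ℕ
queries (output _)    M = 0
queries (query i j A) M = suc (queries (A (M i j)) M)
queries (random _ A)  M = maximum λ x → queries (A x) M

TestingAlgorithm : Set
TestingAlgorithm = (ε : ℚ) (n m : ℕ) → Algorithm n m

record IsTester (P : Property) (T : TestingAlgorithm) : Set where
  field
    accepts : ∀ ε .{{_ : Positive ε}} → ε < 1ℚ → ∀ n m (M : Matrix n m) →
              P M → + 2 / 3 ≤ Pr accept (T ε n m) M
    rejects : ∀ ε .{{_ : Positive ε}} → ε < 1ℚ → ∀ n m (M : Matrix n m) →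
              Far ε P M → + 2 / 3 ≤ Pr reject (T ε n m) M

IsOneSided : Property → TestingAlgorithm → Set
IsOneSided P T = ∀ ε .{{_ : Positive ε}} → ε < 1ℚ → ∀ n m (M : Matrix n m) →
                 P M → Pr accept (T ε n m) M ≡ 1ℚ

------------------------------------------------------------------------
-- Query bounds

Bound : Set
Bound = (s d : ℕ) (ε : ℚ) .{{_ : Positive ε}} → ℚ

-- The constant C is the same for all s, d, ε, n and m.
OneSidedTestable : (ℕ → ℕ → Property) → Bound → Set
OneSidedTestable P f =
  ∃[ C ] ∀ s d → 1 ℕ.≤ s → 1 ℕ.≤ d →
    ∃[ T ] (IsTester (P s d) T × IsOneSided (P s d) T ×
      (∀ ε .{{_ : Positive ε}} → ε < 1ℚ → ∀ n m (M : Matrix n m) →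
         fromℕ (queries (T ε n m) M) ≤ fromℕ C * f s d ε))

binom≤ : ℕ → ℕ → ℕ
binom≤ d s = ∑ {suc s} λ i → d C toℕ i

size : ℕ → ℕ → ℕ
size s d = binom≤ d s ℕ.* 2 ^ d

sizeBound queryBound : Bound
sizeBound  s d ε = (fromℕ (size s d) ÷ ε) {{pos⇒nonZero ε}}
queryBound s d ε = (fromℕ (d ℕ.* size s d) ÷ ε) {{pos⇒nonZero ε}}

-- ⌈log₂ size⌉ + ⌈log₂ ⌈1/ε⌉⌉.  Since size s d ≥ 4 when s, d ≥ 1, every polynomial
-- in log size and log (1/ε) is at most a constant times a power of this sum.
logs : (s d : ℕ) (ε : ℚ) .{{_ : Positive ε}} → ℕ
logs s d ε = ⌈log₂ size s d ⌉ ℕ.+ ⌈log₂ ∣ ceiling ((1/ ε) {{pos⇒nonZero ε}}) ∣ ⌉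

_∈Õ_ : Bound → Bound → Set
f ∈Õ g = ∃[ C ] ∃[ k ] ∀ s d → 1 ℕ.≤ s → 1 ℕ.≤ d → ∀ ε .{{_ : Positive ε}} → ε < 1ℚ →
  f s d ε ≤ fromℕ (C ℕ.* logs s d ε ^ k) * g s d ε

{-# OPTIONS --safe #-}

-- Label every row and column by the set of rectangles through it.  Distinct rows (columns)
-- of a matrix with rank at most d have distinct labels, and the labels of a row and a column
-- share at most s rectangles.  Passing to down-closures, the Harris–Kleitman inequality then
-- gives Sgall's bound: such a matrix has at most binom≤ d s * 2 ^ d pairs (distinct row,
-- distinct column).
--
-- The tester grows a submatrix with distinct rows and columns.  Three kinds of random trials
-- can enlarge it: a row unlike all its rows, a column unlike all its columns, or an entry
-- that disagrees with the submatrix although its row and column look familiar.  If all three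
-- are rare and the submatrix has rank at most d, then blowing the submatrix up gives a nearby
-- matrix of rank at most d.  Row trials cost the width and gain the width in area, and
-- dually for columns, so with the cheaper kind tried first the total cost is proportional to
-- the final area, which Sgall's bound controls.
--
-- For rank exactly d, planting a d × d identity block row by row in a matrix of rank at most
-- d passes through rank exactly d, at the price of d * d entries; matrices too small to
-- absorb this price are read entirely.

module Submission where

open import Defs
import Algebra.Properties.CommutativeMonoid.Sum as Sum
open import Data.Bool.Base using (Bool; true; false; _∧_; if_then_else_)
open import Data.Bool.Properties using () renaming (_≟_ to _≟ᵇ_)
open import Data.Fin.Base as Fin
  using (Fin; zero; suc; toℕ; fromℕ<; inject≤; _↑ˡ_; _↑ʳ_; combine; remQuot)
open import Data.Fin.Properties as Finₚ using (any?; all?)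
open import Data.Fin.Subset using (Subset; inside; outside; _⊆_; _∩_; ∣_∣; ⊥; ⁅_⁆)
open import Data.Fin.Subset.Properties
  using (_⊆?_; _∈?_; anySubset?; ⊆-refl; ⊆-trans; p⊆q⇒∣p∣≤∣q∣; x∈p∩q⁺; out⊆; s⊆s; ∩-zeroˡ; ∩-comm; ∣⊥∣≡0)
import Data.Integer.Base as ℤ
open import Data.Maybe.Base using (Maybe; just; nothing; maybe′)
open import Data.Product.Base using (_×_; _,_; proj₁; proj₂; ∃; ∃-syntax; uncurry)
open import Data.Rational.Base as ℚ using (ℚ; 0ℚ; 1ℚ; Positive)
import Data.Rational.Properties as ℚ
open import Data.Sum.Base using (_⊎_; inj₁; inj₂)
open import Data.Vec.Base as Vec using (Vec; []; _∷_; lookup; tabulate)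
open import Data.Vec.Functional using (Vector) renaming ([] to []ᶠ; _∷_ to _∷ᶠ_; _++_ to _++ᶠ_)
open import Data.Vec.Functional.Properties using (lookup-++ˡ; lookup-++ʳ)
open import Data.Vec.Properties using (lookup∘tabulate; []=⇒lookup; lookup⇒[]=)
open import Function.Base using (_∘_; _$_; flip)
open import Function.Bundles using (mk⇔)
open import Function.Definitions using (Injective)
open import Relation.Binary.PropositionalEquality hiding ([_])
open import Relation.Nullary.Decidable
open import Relation.Nullary.Negation using (contradiction; ¬_)
open import Relation.Unary using (Decidable)

-- Rational arithmetic: averages, powers and rounding of 1/ε

module RationalArithmetic where

  open import Data.Integer.Base using (+_; +[1+_])
  import Data.Integer.Properties as ℤₚ
  open import Data.Nat.Base as ℕ using (ℕ; zero; suc; NonZero; z≤n; s≤s)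
  import Data.Nat.DivMod as ℕ
  import Data.Nat.Properties as ℕₚ
  open import Data.Rational.Base hiding (NonZero; _≃_; *≤*; *<*; *≡*)
  open import Data.Rational.Properties
  import Data.Rational.Solver as ℚ-Solver
  open import Data.Rational.Unnormalised.Base as ℚᵘ using (mkℚᵘ; *≡*; *≤*; _≃_)
  import Data.Rational.Unnormalised.Properties as ℚᵘₚ

  private variable
    a b k : ℕ

  toℚᵘ-fromℕ : ∀ k → toℚᵘ (fromℕ k) ≃ mkℚᵘ (+ k) 0
  toℚᵘ-fromℕ k = toℚᵘ-fromℚᵘ (mkℚᵘ (+ k) 0)

  fromℕ-+ : ∀ a b → fromℕ (a ℕ.+ b) ≡ fromℕ a + fromℕ b
  fromℕ-+ a b = toℚᵘ-injective $ begin
    toℚᵘ (fromℕ (a ℕ.+ b))                ≈⟨ toℚᵘ-fromℕ (a ℕ.+ b) ⟩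
    mkℚᵘ (+ (a ℕ.+ b)) 0                  ≈⟨ *≡* (cong (ℤ._* + 1) (sym (cong₂ ℤ._+_ (ℤₚ.*-identityʳ (+ a)) (ℤₚ.*-identityʳ (+ b))))) ⟩
    mkℚᵘ (+ a) 0 ℚᵘ.+ mkℚᵘ (+ b) 0        ≈⟨ ℚᵘₚ.+-cong (toℚᵘ-fromℕ a) (toℚᵘ-fromℕ b) ⟨
    toℚᵘ (fromℕ a) ℚᵘ.+ toℚᵘ (fromℕ b)    ≈⟨ toℚᵘ-homo-+ (fromℕ a) (fromℕ b) ⟨
    toℚᵘ (fromℕ a + fromℕ b)              ∎
    where open ℚᵘₚ.≃-Reasoning

  fromℕ-* : ∀ a b → fromℕ (a ℕ.* b) ≡ fromℕ a * fromℕ b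
  fromℕ-* a b = toℚᵘ-injective $ begin
    toℚᵘ (fromℕ (a ℕ.* b))                ≈⟨ toℚᵘ-fromℕ (a ℕ.* b) ⟩
    mkℚᵘ (+ (a ℕ.* b)) 0                  ≈⟨ *≡* (cong (ℤ._* + 1) (ℤₚ.pos-* a b)) ⟩
    mkℚᵘ (+ a) 0 ℚᵘ.* mkℚᵘ (+ b) 0        ≈⟨ ℚᵘₚ.*-cong (toℚᵘ-fromℕ a) (toℚᵘ-fromℕ b) ⟨
    toℚᵘ (fromℕ a) ℚᵘ.* toℚᵘ (fromℕ b)    ≈⟨ toℚᵘ-homo-* (fromℕ a) (fromℕ b) ⟨
    toℚᵘ (fromℕ a * fromℕ b)              ∎
    where open ℚᵘₚ.≃-Reasoning

  fromℕ-mono-≤ : a ℕ.≤ b → fromℕ a ≤ fromℕ b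
  fromℕ-mono-≤ {a} {b} a≤b = toℚᵘ-cancel-≤ $
    ℚᵘₚ.≤-respˡ-≃ (ℚᵘₚ.≃-sym (toℚᵘ-fromℕ a)) $ ℚᵘₚ.≤-respʳ-≃ (ℚᵘₚ.≃-sym (toℚᵘ-fromℕ b)) $
    *≤* (ℤₚ.*-monoʳ-≤-nonNeg (+ 1) (ℤ.+≤+ a≤b))

  fromℕ-cancel-< : fromℕ a < fromℕ b → a ℕ.< b
  fromℕ-cancel-< a<b = ℕₚ.≰⇒> λ b≤a → <-irrefl refl (<-≤-trans a<b (fromℕ-mono-≤ b≤a))

  0≤fromℕ : ∀ k → 0ℚ ≤ fromℕ k
  0≤fromℕ k = fromℕ-mono-≤ {0} {k} z≤n

  fromℕ-nonNeg : ∀ k → NonNegative (fromℕ k)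
  fromℕ-nonNeg k = nonNegative (0≤fromℕ k)

  fromℕ-pos : ∀ k .{{_ : NonZero k}} → Positive (fromℕ k)
  fromℕ-pos (suc k) = normalize-pos (suc k) 1

  fromℕ*frac : ∀ a b .{{_ : NonZero b}} → fromℕ b * (+ a / b) ≡ fromℕ a
  fromℕ*frac a b@(suc b-1) = toℚᵘ-injective $ begin
    toℚᵘ (fromℕ b * (+ a / b))             ≈⟨ toℚᵘ-homo-* (fromℕ b) (+ a / b) ⟩
    toℚᵘ (fromℕ b) ℚᵘ.* toℚᵘ (+ a / b)     ≈⟨ ℚᵘₚ.*-cong (toℚᵘ-fromℕ b) (toℚᵘ-fromℚᵘ (mkℚᵘ (+ a) b-1)) ⟩
    mkℚᵘ (+ b) 0 ℚᵘ.* mkℚᵘ (+ a) b-1       ≈⟨ *≡* (trans (ℤₚ.*-identityʳ (+ b ℤ.* + a)) (trans (ℤₚ.*-comm (+ b) (+ a)) (cong (λ x → + a ℤ.* + suc x) (sym (ℕₚ.+-identityʳ b-1))))) ⟩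
    mkℚᵘ (+ a) 0                           ≈⟨ toℚᵘ-fromℕ a ⟨
    toℚᵘ (fromℕ a)                         ∎
    where open ℚᵘₚ.≃-Reasoning

  average : ∀ k .{{_ : NonZero k}} → Vector ℚ k → ℚ
  average k f = (+ 1 / k) * ∑ℚ f

  1/k*k : ∀ k .{{_ : NonZero k}} → (+ 1 / k) * fromℕ k ≡ 1ℚ
  1/k*k k = trans (*-comm (+ 1 / k) (fromℕ k)) (fromℕ*frac 1 k)

  1/k-nonNeg : ∀ k .{{_ : NonZero k}} → NonNegative (+ 1 / k)
  1/k-nonNeg k = normalize-nonNeg 1 k

  ∑ℚ-cong : {f g : Vector ℚ k} → (∀ x → f x ≡ g x) → ∑ℚ f ≡ ∑ℚ g
  ∑ℚ-cong {zero}  eq = refl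
  ∑ℚ-cong {suc k} eq = cong₂ _+_ (eq zero) (∑ℚ-cong (eq ∘ suc))

  ∑ℚ-const : ∀ k q → ∑ℚ {k} (λ _ → q) ≡ fromℕ k * q
  ∑ℚ-const zero    q = sym (*-zeroˡ q)
  ∑ℚ-const (suc k) q = begin
    q + ∑ℚ {k} (λ _ → q)      ≡⟨ cong₂ _+_ (sym (*-identityˡ q)) (∑ℚ-const k q) ⟩
    1ℚ * q + fromℕ k * q      ≡⟨ *-distribʳ-+ q 1ℚ (fromℕ k) ⟨
    (1ℚ + fromℕ k) * q        ≡⟨ cong (_* q) (fromℕ-+ 1 k) ⟨
    fromℕ (suc k) * q         ∎
    where open ≡-Reasoning

  ∑ℚ-+ : (f g : Vector ℚ k) → ∑ℚ (λ x → f x + g x) ≡ ∑ℚ f + ∑ℚ g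
  ∑ℚ-+ {zero}  f g = refl
  ∑ℚ-+ {suc k} f g = trans (cong (λ z → f zero + g zero + z) (∑ℚ-+ (f ∘ suc) (g ∘ suc)))
    (solve 4 (λ a b c d → a :+ b :+ (c :+ d) := a :+ c :+ (b :+ d)) refl (f zero) (g zero) _ _)
    where open ℚ-Solver.+-*-Solver

  average-const : ∀ k .{{_ : NonZero k}} {f : Vector ℚ k} {q} → (∀ x → f x ≡ q) → average k f ≡ q
  average-const k {f} {q} f≡q = begin
    (+ 1 / k) * ∑ℚ f              ≡⟨ cong ((+ 1 / k) *_) (trans (∑ℚ-cong f≡q) (∑ℚ-const k q)) ⟩
    (+ 1 / k) * (fromℕ k * q)     ≡⟨ *-assoc (+ 1 / k) (fromℕ k) q ⟨
    (+ 1 / k) * fromℕ k * q       ≡⟨ cong (_* q) (1/k*k k) ⟩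
    1ℚ * q                        ≡⟨ *-identityˡ q ⟩
    q                             ∎
    where open ≡-Reasoning

  ∑ℚ-≤ : ∀ {α β} (c : Vector ℕ k) {f : Vector ℚ k} → (∀ x → f x ≤ α + β * fromℕ (c x)) →
         ∑ℚ f ≤ fromℕ k * α + β * fromℕ (∑ c)
  ∑ℚ-≤ {zero}  {α} {β} c f≤ = ≤-reflexive (sym (trans (cong₂ _+_ (*-zeroˡ α) (*-zeroʳ β)) refl))
  ∑ℚ-≤ {suc k} {α} {β} c {f} f≤ = begin
    f zero + ∑ℚ (f ∘ suc)
      ≤⟨ +-mono-≤ (f≤ zero) (∑ℚ-≤ {α = α} {β} (c ∘ suc) (f≤ ∘ suc)) ⟩
    α + β * fromℕ (c zero) + (fromℕ k * α + β * fromℕ (∑ (c ∘ suc)))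
      ≡⟨ solve 5 (λ α β x y z → α :+ β :* x :+ (y :* α :+ β :* z) := (con 1ℚ :+ y) :* α :+ β :* (x :+ z))
           refl α β (fromℕ (c zero)) (fromℕ k) (fromℕ (∑ (c ∘ suc))) ⟩
    (1ℚ + fromℕ k) * α + β * (fromℕ (c zero) + fromℕ (∑ (c ∘ suc)))
      ≡⟨ cong₂ (λ x y → x * α + β * y) (fromℕ-+ 1 k) (fromℕ-+ (c zero) (∑ (c ∘ suc))) ⟨
    fromℕ (suc k) * α + β * fromℕ (∑ c) ∎
    where
    open ≤-Reasoning
    open ℚ-Solver.+-*-Solver

  -- The induction step for repeated trials: `c` will be the indicator of a miss and `β` the price
  -- of one. The last hypothesis says, cleared of denominators, that the mean of `c` is at most
  -- w/(1+w).
  average-≤ : ∀ k .{{_ : NonZero k}} {α β} w (c : Vector ℕ k) {f : Vector ℚ k} → 0ℚ ≤ β →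
              (∀ x → f x ≤ α + β * fromℕ (c x)) → ∑ c ℕ.* suc w ℕ.≤ w ℕ.* k →
              average k f ≤ α + β * (+ w / suc w)
  average-≤ k {α} {β} w c {f} 0≤β f≤ c≤ = begin
    (+ 1 / k) * ∑ℚ f
      ≤⟨ *-monoˡ-≤-nonNeg (+ 1 / k) {{1/k-nonNeg k}} (∑ℚ-≤ {α = α} {β} c f≤) ⟩
    (+ 1 / k) * (fromℕ k * α + β * fromℕ (∑ c))
      ≤⟨ *-monoˡ-≤-nonNeg (+ 1 / k) {{1/k-nonNeg k}} (+-monoʳ-≤ (fromℕ k * α) (*-monoˡ-≤-nonNeg β {{nonNegative 0≤β}} ∑c≤)) ⟩
    (+ 1 / k) * (fromℕ k * α + β * (fromℕ k * r))
      ≡⟨ solve 5 (λ i k α β r → i :* (k :* α :+ β :* (k :* r)) := i :* k :* (α :+ β :* r)) refl (+ 1 / k) (fromℕ k) α β r ⟩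
    (+ 1 / k) * fromℕ k * (α + β * r)
      ≡⟨ cong (_* (α + β * r)) (1/k*k k) ⟩
    1ℚ * (α + β * r)
      ≡⟨ *-identityˡ (α + β * r) ⟩
    α + β * r ∎
    where
    open ≤-Reasoning
    open ℚ-Solver.+-*-Solver
    r : ℚ
    r = + w / suc w
    ∑c≤ : fromℕ (∑ c) ≤ fromℕ k * r
    ∑c≤ = *-cancelʳ-≤-pos (fromℕ (suc w)) {{fromℕ-pos (suc w)}} $ begin
      fromℕ (∑ c) * fromℕ (suc w)    ≡⟨ fromℕ-* (∑ c) (suc w) ⟨
      fromℕ (∑ c ℕ.* suc w)          ≤⟨ fromℕ-mono-≤ c≤ ⟩
      fromℕ (w ℕ.* k)                ≡⟨ fromℕ-* w k ⟩
      fromℕ w * fromℕ k              ≡⟨ cong (_* fromℕ k) (fromℕ*frac w (suc w)) ⟨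
      fromℕ (suc w) * r * fromℕ k    ≡⟨ solve 3 (λ x r k → x :* r :* k := k :* r :* x) refl (fromℕ (suc w)) r (fromℕ k) ⟩
      fromℕ k * r * fromℕ (suc w)    ∎

  average-≤-const : ∀ k .{{_ : NonZero k}} {α} {f : Vector ℚ k} → (∀ x → f x ≤ α) → average k f ≤ α
  average-≤-const k {α} {f} f≤ = begin
    (+ 1 / k) * ∑ℚ f                     ≤⟨ *-monoˡ-≤-nonNeg (+ 1 / k) {{1/k-nonNeg k}} (∑ℚ-mono f≤) ⟩
    (+ 1 / k) * ∑ℚ {k} (λ _ → α)         ≡⟨ average-const k (λ _ → refl) ⟩
    α                                    ∎
    where
    open ≤-Reasoning
    ∑ℚ-mono : ∀ {k} {f g : Vector ℚ k} → (∀ x → f x ≤ g x) → ∑ℚ f ≤ ∑ℚ g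
    ∑ℚ-mono {zero}  f≤g = ≤-refl
    ∑ℚ-mono {suc k} f≤g = +-mono-≤ (f≤g zero) (∑ℚ-mono (f≤g ∘ suc))

  infixr 8 _^ℚ_

  -- The new factor stands on the right, so that the bound produced by `average-≤` with `β = q ^ℚ t`
  -- is `q ^ℚ suc t` by computation.
  _^ℚ_ : ℚ → ℕ → ℚ
  q ^ℚ zero  = 1ℚ
  q ^ℚ suc t = q ^ℚ t * q

  ^ℚ-nonNeg : ∀ {q} → 0ℚ ≤ q → ∀ t → 0ℚ ≤ q ^ℚ t
  ^ℚ-nonNeg 0≤q zero    = fromℕ-mono-≤ {0} {1} z≤n
  ^ℚ-nonNeg {q} 0≤q (suc t) = subst (_≤ q ^ℚ t * q) (*-zeroˡ q)
    (*-monoʳ-≤-nonNeg q {{nonNegative 0≤q}} (^ℚ-nonNeg 0≤q t))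

  frac-^ : ∀ w t → fromℕ (suc w ℕ.^ t) * (+ w / suc w) ^ℚ t ≡ fromℕ (w ℕ.^ t)
  frac-^ w zero    = refl
  frac-^ w (suc t) = begin
    fromℕ (suc w ℕ.* suc w ℕ.^ t) * (r ^ℚ t * r)            ≡⟨ cong (_* (r ^ℚ t * r)) (fromℕ-* (suc w) (suc w ℕ.^ t)) ⟩
    fromℕ (suc w) * fromℕ (suc w ℕ.^ t) * (r ^ℚ t * r)      ≡⟨ solve 4 (λ x y z r → x :* y :* (z :* r) := x :* r :* (y :* z)) refl (fromℕ (suc w)) (fromℕ (suc w ℕ.^ t)) (r ^ℚ t) r ⟩
    fromℕ (suc w) * r * (fromℕ (suc w ℕ.^ t) * r ^ℚ t)      ≡⟨ cong₂ _*_ (fromℕ*frac w (suc w)) (frac-^ w t) ⟩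
    fromℕ w * fromℕ (w ℕ.^ t)                               ≡⟨ fromℕ-* w (w ℕ.^ t) ⟨
    fromℕ (w ℕ.^ suc t)                                     ∎
    where
    open ≡-Reasoning
    open ℚ-Solver.+-*-Solver
    r : ℚ
    r = + w / suc w

  0≤frac : ∀ w → 0ℚ ≤ + w / suc w
  0≤frac w = nonNegative⁻¹ (+ w / suc w) {{normalize-nonNeg w (suc w)}}

  -- Multiplying by three times (1+w)^t clears all denominators. It serves for a union bound over
  -- `z` sweeps, each missing with probability at most (w/(1+w))^t.
  *frac-^≤⅓ : ∀ z w t → 3 ℕ.* z ℕ.* w ℕ.^ t ℕ.≤ suc w ℕ.^ t → fromℕ z * (+ w / suc w) ^ℚ t ≤ + 1 / 3
  *frac-^≤⅓ z w t h = *-cancelˡ-≤-pos (fromℕ (3 ℕ.* P)) {{fromℕ-pos (3 ℕ.* P) {{ℕₚ.m*n≢0 3 P {{_}} {{ℕₚ.m^n≢0 (suc w) t}}}}}} $ begin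
    fromℕ (3 ℕ.* P) * (fromℕ z * δ)             ≡⟨ cong (_* (fromℕ z * δ)) (fromℕ-* 3 P) ⟩
    fromℕ 3 * fromℕ P * (fromℕ z * δ)           ≡⟨ solve 4 (λ a p z δ → a :* p :* (z :* δ) := a :* z :* (p :* δ)) refl (fromℕ 3) (fromℕ P) (fromℕ z) δ ⟩
    fromℕ 3 * fromℕ z * (fromℕ P * δ)           ≡⟨ cong₂ _*_ (sym (fromℕ-* 3 z)) (frac-^ w t) ⟩
    fromℕ (3 ℕ.* z) * fromℕ (w ℕ.^ t)           ≡⟨ fromℕ-* (3 ℕ.* z) (w ℕ.^ t) ⟨
    fromℕ (3 ℕ.* z ℕ.* w ℕ.^ t)                 ≤⟨ fromℕ-mono-≤ h ⟩
    fromℕ P                                     ≡⟨ *-identityˡ (fromℕ P) ⟨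
    fromℕ 3 * (+ 1 / 3) * fromℕ P               ≡⟨ solve 3 (λ a b p → a :* b :* p := a :* p :* b) refl (fromℕ 3) (+ 1 / 3) (fromℕ P) ⟩
    fromℕ 3 * fromℕ P * (+ 1 / 3)               ≡⟨ cong (_* (+ 1 / 3)) (fromℕ-* 3 P) ⟨
    fromℕ (3 ℕ.* P) * (+ 1 / 3)                 ∎
    where
    open ≤-Reasoning
    open ℚ-Solver.+-*-Solver
    P = suc w ℕ.^ t
    δ = (+ w / suc w) ^ℚ t

  -- Lies between 1/ε and 2/ε when 0 < ε < 1.
  recip : ℚ → ℕ
  recip (mkℚ +[1+ k ] e _) = suc (suc e ℕ./ suc k)
  recip _                  = 1

  private
    numerator-eq : ∀ ε .{{_ : Positive ε}} → ε * fromℕ (↧ₙ ε) ≡ fromℕ ℤ.∣ ↥ ε ∣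
    numerator-eq ε@(mkℚ +[1+ k ] e _) = toℚᵘ-injective $ begin
      toℚᵘ (ε * fromℕ (suc e))               ≈⟨ toℚᵘ-homo-* ε (fromℕ (suc e)) ⟩
      toℚᵘ ε ℚᵘ.* toℚᵘ (fromℕ (suc e))       ≈⟨ ℚᵘₚ.*-congˡ {toℚᵘ ε} (toℚᵘ-fromℕ (suc e)) ⟩
      mkℚᵘ +[1+ k ] e ℚᵘ.* mkℚᵘ (+ suc e) 0  ≈⟨ *≡* (trans (ℤₚ.*-identityʳ (+[1+ k ] ℤ.* + suc e)) (cong (λ x → +[1+ k ] ℤ.* + suc x) (sym (ℕₚ.*-identityʳ e)))) ⟩
      mkℚᵘ (+ suc k) 0                       ≈⟨ toℚᵘ-fromℕ (suc k) ⟨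
      toℚᵘ (fromℕ (suc k))                   ∎
      where open ℚᵘₚ.≃-Reasoning

    -- After multiplication by the denominator of `ε`, comparisons with `recip ε * ε` take place in
    -- the natural numbers.
    scale : ∀ ε .{{_ : Positive ε}} q → fromℕ q * ε * fromℕ (↧ₙ ε) ≡ fromℕ (q ℕ.* ℤ.∣ ↥ ε ∣)
    scale ε q = trans (*-assoc (fromℕ q) ε (fromℕ (↧ₙ ε)))
      (trans (cong (fromℕ q *_) (numerator-eq ε)) (sym (fromℕ-* q ℤ.∣ ↥ ε ∣)))

  1≤recip*ε : ∀ ε .{{_ : Positive ε}} → 1ℚ ≤ fromℕ (recip ε) * ε
  1≤recip*ε ε@(mkℚ +[1+ k ] e _) = *-cancelʳ-≤-pos (fromℕ (suc e)) {{fromℕ-pos (suc e)}} $ begin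
    1ℚ * fromℕ (suc e)                        ≡⟨ *-identityˡ (fromℕ (suc e)) ⟩
    fromℕ (suc e)                             ≤⟨ fromℕ-mono-≤ E≤qK ⟩
    fromℕ (recip ε ℕ.* suc k)                 ≡⟨ scale ε (recip ε) ⟨
    fromℕ (recip ε) * ε * fromℕ (suc e)       ∎
    where
    open ≤-Reasoning
    E≤qK : suc e ℕ.≤ recip ε ℕ.* suc k
    -- Division with remainder: the remainder is below the divisor, and `recip` is the quotient plus
    -- one.
    E≤qK = ℕₚ.≤-trans (ℕₚ.≤-reflexive (ℕ.m≡m%n+[m/n]*n (suc e) (suc k)))
      (ℕₚ.+-monoˡ-≤ (suc e ℕ./ suc k ℕ.* suc k) (ℕₚ.<⇒≤ (ℕ.m%n<n (suc e) (suc k))))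

  recip*ε≤2 : ∀ ε .{{_ : Positive ε}} → ε < 1ℚ → fromℕ (recip ε) * ε ≤ fromℕ 2
  recip*ε≤2 ε@(mkℚ +[1+ k ] e _) ε<1 = *-cancelʳ-≤-pos (fromℕ (suc e)) {{fromℕ-pos (suc e)}} $ begin
    fromℕ (recip ε) * ε * fromℕ (suc e)       ≡⟨ scale ε (recip ε) ⟩
    fromℕ (recip ε ℕ.* suc k)                 ≤⟨ fromℕ-mono-≤ qK≤2E ⟩
    fromℕ (2 ℕ.* suc e)                       ≡⟨ fromℕ-* 2 (suc e) ⟩
    fromℕ 2 * fromℕ (suc e)                   ∎
    where
    open ≤-Reasoning
    K<E : suc k ℕ.< suc e
    K<E = fromℕ-cancel-< $ subst₂ _<_ (numerator-eq ε) (*-identityˡ (fromℕ (suc e)))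
      (*-monoˡ-<-pos (fromℕ (suc e)) {{fromℕ-pos (suc e)}} ε<1)
    qK≤2E : recip ε ℕ.* suc k ℕ.≤ 2 ℕ.* suc e
    -- The added one contributes `suc k`, which is below the denominator because ε < 1; the quotient
    -- contributes at most the denominator.
    qK≤2E = ℕₚ.+-mono-≤ (ℕₚ.<⇒≤ K<E)
      (ℕₚ.≤-trans (ℕ.m/n*n≤m (suc e) (suc k)) (ℕₚ.≤-reflexive (sym (ℕₚ.+-identityʳ (suc e)))))

  1≤recip : ∀ ε → 1 ℕ.≤ recip ε
  1≤recip (mkℚ +[1+ k ] e _)     = s≤s z≤n
  1≤recip (mkℚ (+ 0) e _)        = s≤s z≤n
  1≤recip (mkℚ (ℤ.-[1+ k ]) e _) = s≤s z≤n

  -- Turns the farness hypothesis into an inequality between natural numbers, by 1 ≤ `recip ε * ε`.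
  ε*<⇒<recip* : ∀ ε .{{_ : Positive ε}} {a b} → ε * fromℕ a < fromℕ b → a ℕ.< recip ε ℕ.* b
  ε*<⇒<recip* ε {a} {b} εa<b = fromℕ-cancel-< $ begin-strict
    fromℕ a                         ≡⟨ *-identityˡ (fromℕ a) ⟨
    1ℚ * fromℕ a                    ≤⟨ *-monoʳ-≤-nonNeg (fromℕ a) {{fromℕ-nonNeg a}} (1≤recip*ε ε) ⟩
    fromℕ q * ε * fromℕ a           ≡⟨ *-assoc (fromℕ q) ε (fromℕ a) ⟩
    fromℕ q * (ε * fromℕ a)         <⟨ *-monoʳ-<-pos (fromℕ q) {{fromℕ-pos q {{ℕ.>-nonZero (1≤recip ε)}}}} εa<b ⟩
    fromℕ q * fromℕ b               ≡⟨ fromℕ-* q b ⟨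
    fromℕ (q ℕ.* b)                 ∎
    where
    open ≤-Reasoning
    q = recip ε

  -- Turns a query count in terms of `recip ε` back into one in terms of 1/ε; rounding loses the
  -- factor 2.
  recip*-≤ : ∀ ε .{{_ : Positive ε}} → ε < 1ℚ → ∀ c x →
             fromℕ (c ℕ.* (recip ε ℕ.* x)) ≤ fromℕ (c ℕ.* 2) * (fromℕ x ÷ ε) {{pos⇒nonZero ε}}
  recip*-≤ ε ε<1 c x = *-cancelʳ-≤-pos ε $ begin
    fromℕ (c ℕ.* (q ℕ.* x)) * ε                   ≡⟨ cong (_* ε) (trans (fromℕ-* c (q ℕ.* x)) (cong (fromℕ c *_) (fromℕ-* q x))) ⟩
    fromℕ c * (fromℕ q * fromℕ x) * ε             ≡⟨ solve 4 (λ c q x ε → c :* (q :* x) :* ε := c :* x :* (q :* ε)) refl (fromℕ c) (fromℕ q) (fromℕ x) ε ⟩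
    fromℕ c * fromℕ x * (fromℕ q * ε)             ≤⟨ *-monoˡ-≤-nonNeg (fromℕ c * fromℕ x) {{cx-nonNeg}} (recip*ε≤2 ε ε<1) ⟩
    fromℕ c * fromℕ x * fromℕ 2                   ≡⟨ *-identityʳ _ ⟨
    fromℕ c * fromℕ x * fromℕ 2 * 1ℚ              ≡⟨ cong (fromℕ c * fromℕ x * fromℕ 2 *_) (*-inverseˡ ε {{pos⇒nonZero ε}}) ⟨
    fromℕ c * fromℕ x * fromℕ 2 * (i * ε)         ≡⟨ solve 5 (λ c x y i ε → c :* x :* y :* (i :* ε) := c :* y :* (x :* i) :* ε) refl (fromℕ c) (fromℕ x) (fromℕ 2) i ε ⟩
    fromℕ c * fromℕ 2 * (fromℕ x * i) * ε         ≡⟨ cong (λ z → z * (fromℕ x * i) * ε) (fromℕ-* c 2) ⟨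
    fromℕ (c ℕ.* 2) * (fromℕ x * i) * ε           ∎
    where
    open ≤-Reasoning
    open ℚ-Solver.+-*-Solver
    q = recip ε
    i = (1/ ε) {{pos⇒nonZero ε}}
    cx-nonNeg : NonNegative (fromℕ c * fromℕ x)
    cx-nonNeg = subst NonNegative (fromℕ-* c x) (fromℕ-nonNeg (c ℕ.* x))

  ÷-mono-≤ : ∀ ε .{{_ : Positive ε}} {a} b c → a ℕ.≤ b ℕ.* c →
             (fromℕ a ÷ ε) {{pos⇒nonZero ε}} ≤ fromℕ b * (fromℕ c ÷ ε) {{pos⇒nonZero ε}}
  ÷-mono-≤ ε {a} b c a≤bc = begin
    fromℕ a * i               ≤⟨ *-monoʳ-≤-nonNeg i {{i-nonNeg}} (fromℕ-mono-≤ a≤bc) ⟩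
    fromℕ (b ℕ.* c) * i       ≡⟨ cong (_* i) (fromℕ-* b c) ⟩
    fromℕ b * fromℕ c * i     ≡⟨ *-assoc (fromℕ b) (fromℕ c) i ⟩
    fromℕ b * (fromℕ c * i)   ∎
    where
    open ≤-Reasoning
    i = (1/ ε) {{pos⇒nonZero ε}}
    i-nonNeg : NonNegative i
    i-nonNeg = pos⇒nonNeg i {{1/pos⇒pos ε}}

  +≡1∧≤⅓⇒⅔≤ : ∀ {p q} → p + q ≡ 1ℚ → p ≤ + 1 / 3 → + 2 / 3 ≤ q
  +≡1∧≤⅓⇒⅔≤ {p} {q} p+q≡1 p≤⅓ = begin
    + 2 / 3                    ≡⟨ cong (_- + 1 / 3) p+q≡1 ⟨
    p + q - + 1 / 3            ≤⟨ +-monoˡ-≤ (- (+ 1 / 3)) (+-monoˡ-≤ q p≤⅓) ⟩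
    + 1 / 3 + q - + 1 / 3      ≡⟨ solve 2 (λ t q → t :+ q :- t := q) refl (+ 1 / 3) q ⟩
    q                          ∎
    where
    open ≤-Reasoning
    open ℚ-Solver.+-*-Solver

open RationalArithmetic
open import Data.Nat.Base hiding (_⊓_)
open import Data.Nat.Combinatorics using (_C_; nCk+nC[k+1]≡[n+1]C[k+1])
open import Data.Nat.Logarithm using (⌈log₂_⌉; ⌈log₂⌉-mono-≤; ⌈log₂2^n⌉≡n)
open import Data.Nat.Properties
open import Data.Nat.Solver using (module +-*-Solver)
open Sum +-0-commutativeMonoid using (∑-distrib-+)

private variable
  n m a b d e k s : ℕ
  S P : Set
  v : Verdict

-- Sgall's bound on cross-intersecting families

Family : ℕ → Set
Family d = Subset d → Bool

sizeOf : Family d → ℕ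
sizeOf {zero}  F = if F [] then 1 else 0
sizeOf {suc d} F = sizeOf (F ∘ (outside ∷_)) + sizeOf (F ∘ (inside ∷_))

_⊑_ : Family d → Family d → Set
F ⊑ G = ∀ p → F p ≡ true → G p ≡ true

_⊓_ : Family d → Family d → Family d
(F ⊓ G) p = F p ∧ G p

DownClosed : Family d → Set
DownClosed F = ∀ p q → p ⊆ q → F q ≡ true → F p ≡ true

sizeOf-mono : (F G : Family d) → F ⊑ G → sizeOf F ≤ sizeOf G
sizeOf-mono {zero} F G F⊑G with F [] in eq
... | false = z≤n
... | true rewrite F⊑G [] eq = ≤-refl
sizeOf-mono {suc d} F G F⊑G = +-mono-≤ (sizeOf-mono (F ∘ (outside ∷_)) (G ∘ (outside ∷_)) (λ p → F⊑G (outside ∷ p)))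
                                      (sizeOf-mono (F ∘ (inside ∷_)) (G ∘ (inside ∷_)) (λ p → F⊑G (inside ∷ p)))

sizeOf≤2^d : (F : Family d) → sizeOf F ≤ 2 ^ d
sizeOf≤2^d {zero} F with F []
... | false = z≤n
... | true  = ≤-refl
sizeOf≤2^d {suc d} F = begin
  sizeOf (F ∘ (outside ∷_)) + sizeOf (F ∘ (inside ∷_)) ≤⟨ +-mono-≤ (sizeOf≤2^d (F ∘ (outside ∷_))) (sizeOf≤2^d (F ∘ (inside ∷_))) ⟩
  2 ^ d + 2 ^ d                                        ≡⟨ cong (2 ^ d +_) (+-identityʳ _) ⟨
  2 ^ suc d                                            ∎
  where open ≤-Reasoning

-- The position of `p` when the members of `F` are listed in the order in which `sizeOf` counts
-- them. It converts injections into `F` into injections between finite types.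
index : (F : Family d) (p : Subset d) → F p ≡ true → Fin (sizeOf F)
index {zero}  F []            Fp rewrite Fp = zero
index {suc d} F (outside ∷ p) Fp = index (F ∘ (outside ∷_)) p Fp ↑ˡ _
index {suc d} F (inside  ∷ p) Fp = _ ↑ʳ index (F ∘ (inside ∷_)) p Fp

↑ˡ≢↑ʳ : {i : Fin n} {j : Fin m} → i ↑ˡ m ≢ n ↑ʳ j
↑ˡ≢↑ʳ {n = n} {m} {i} {j} eq
  with () ← trans (sym (Finₚ.splitAt-↑ˡ n i m)) (trans (cong (Fin.splitAt n) eq) (Finₚ.splitAt-↑ʳ n m j))

index-injective : (F : Family d) (p q : Subset d) (Fp : F p ≡ true) (Fq : F q ≡ true) →
                  index F p Fp ≡ index F q Fq → p ≡ q
index-injective {zero}  F []            []            Fp Fq eq = refl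
index-injective {suc d} F (outside ∷ p) (outside ∷ q) Fp Fq eq =
  cong (outside ∷_) (index-injective _ p q Fp Fq (Finₚ.↑ˡ-injective _ _ _ eq))
index-injective {suc d} F (inside  ∷ p) (inside  ∷ q) Fp Fq eq =
  cong (inside ∷_) (index-injective _ p q Fp Fq (Finₚ.↑ʳ-injective _ _ _ eq))
index-injective {suc d} F (outside ∷ p) (inside  ∷ q) Fp Fq eq = contradiction eq ↑ˡ≢↑ʳ
index-injective {suc d} F (inside  ∷ p) (outside ∷ q) Fp Fq eq = contradiction (sym eq) ↑ˡ≢↑ʳ

injection⇒≤sizeOf : (F : Family d) {f : Fin a → Subset d} →
                    (∀ i → F (f i) ≡ true) → Injective _≡_ _≡_ f → a ≤ sizeOf F
injection⇒≤sizeOf F {f} F∘f f-inj = Finₚ.injective⇒≤ {f = λ i → index F (f i) (F∘f i)} λ {i} {j} eq →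
  f-inj (index-injective F (f i) (f j) (F∘f i) (F∘f j) eq)

-- The Harris–Kleitman correlation inequality.
sizeOf-⊓ : (F G : Family d) → DownClosed F → DownClosed G →
           sizeOf F * sizeOf G ≤ 2 ^ d * sizeOf (F ⊓ G)
sizeOf-⊓ {zero} F G _ _ with F [] | G []
... | false | _     = z≤n
... | true  | false = z≤n
... | true  | true  = ≤-refl
sizeOf-⊓ {suc d} F G F↓ G↓ = chebyshev (2 ^ d)
  -- Deleting the first element keeps a set in a down-closed family, so each inside section lies in
  -- the outside one.
  (sizeOf-mono F₁ F₀ (λ p → F↓ _ _ (out⊆ ⊆-refl))) (sizeOf-mono G₁ G₀ (λ p → G↓ _ _ (out⊆ ⊆-refl)))
  (sizeOf-⊓ F₀ G₀ (λ p q → F↓ _ _ ∘ s⊆s) (λ p q → G↓ _ _ ∘ s⊆s))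
  (sizeOf-⊓ F₁ G₁ (λ p q → F↓ _ _ ∘ s⊆s) (λ p q → G↓ _ _ ∘ s⊆s))
  where
  F₀ F₁ G₀ G₁ : Family d
  F₀ = F ∘ (outside ∷_)
  F₁ = F ∘ (inside  ∷_)
  G₀ = G ∘ (outside ∷_)
  G₁ = G ∘ (inside  ∷_)
  open ≤-Reasoning
  -- Chebyshev's sum inequality for two terms: twice f₀g₀ + f₁g₁ exceeds (f₀ + f₁)(g₀ + g₁) by (f₀ -
  -- f₁)(g₀ - g₁), which is nonnegative as both pairs are ordered alike.
  chebyshev : ∀ {f₀ f₁ g₀ g₁ h₀ h₁} e → f₁ ≤ f₀ → g₁ ≤ g₀ → f₀ * g₀ ≤ e * h₀ → f₁ * g₁ ≤ e * h₁ →
              (f₀ + f₁) * (g₀ + g₁) ≤ 2 * e * (h₀ + h₁)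
  chebyshev {f₁ = f₁} {g₁ = g₁} {h₀} {h₁} e f₁≤f₀ g₁≤g₀ p q
    with f , refl ← m≤n⇒∃[o]m+o≡n f₁≤f₀ | g , refl ← m≤n⇒∃[o]m+o≡n g₁≤g₀ = begin
    (f₁ + f + f₁) * (g₁ + g + g₁)                 ≤⟨ m≤m+n _ (f * g) ⟩
    (f₁ + f + f₁) * (g₁ + g + g₁) + f * g         ≡⟨ solve 4 (λ f₁ f g₁ g →
      (f₁ :+ f :+ f₁) :* (g₁ :+ g :+ g₁) :+ f :* g :=
      con 2 :* ((f₁ :+ f) :* (g₁ :+ g) :+ f₁ :* g₁)) refl f₁ f g₁ g ⟩
    2 * ((f₁ + f) * (g₁ + g) + f₁ * g₁)           ≤⟨ *-monoʳ-≤ 2 (+-mono-≤ p q) ⟩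
    2 * (e * h₀ + e * h₁)                         ≡⟨ solve 3 (λ e h₀ h₁ →
      con 2 :* (e :* h₀ :+ e :* h₁) := con 2 :* e :* (h₀ :+ h₁)) refl e h₀ h₁ ⟩
    2 * e * (h₀ + h₁)                             ∎
    where open +-*-Solver

-- Written with `<? suc s`, so that fixing the first element of the set yields `atMost` again by
-- computation.
atMost : ℕ → Family d
atMost s p = does (∣ p ∣ <? suc s)

binom≤-zeroʳ : ∀ d → binom≤ d 0 ≡ 1
binom≤-zeroʳ zero    = refl
binom≤-zeroʳ (suc d) = refl

binom≤-zeroˡ : ∀ s → binom≤ 0 s ≡ 1
binom≤-zeroˡ s = cong suc (Sum.sum-replicate-zero +-0-commutativeMonoid s)

-- Pascal's rule summed over the sizes; it matches the split of `sizeOf` by the first element.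
binom≤-suc : ∀ d s → binom≤ (suc d) (suc s) ≡ binom≤ d (suc s) + binom≤ d s
binom≤-suc d s = begin
  1 + ∑ (λ i → suc d C suc (toℕ {suc s} i))
    ≡⟨ cong (1 +_) (Sum.sum-cong-≗ +-0-commutativeMonoid {suc s} (λ i → nCk+nC[k+1]≡[n+1]C[k+1] d (toℕ i))) ⟨
  1 + ∑ (λ i → d C toℕ {suc s} i + d C suc (toℕ i))
    ≡⟨ cong (1 +_) (∑-distrib-+ (λ i → d C toℕ {suc s} i) (λ i → d C suc (toℕ i))) ⟩
  1 + (binom≤ d s + ∑ (λ i → d C suc (toℕ {suc s} i)))
    ≡⟨ solve 2 (λ x y → con 1 :+ (x :+ y) := con 1 :+ y :+ x) refl (binom≤ d s) _ ⟩
  binom≤ d (suc s) + binom≤ d s ∎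
  where
  open ≡-Reasoning
  open +-*-Solver

sizeOf-atMost : ∀ d s → sizeOf {d} (atMost s) ≡ binom≤ d s
sizeOf-atMost zero    s       = sym (binom≤-zeroˡ s)
sizeOf-atMost (suc d) zero    = begin
  sizeOf {d} (atMost 0) + sizeOf {d} (λ _ → false) ≡⟨ cong₂ _+_ (sizeOf-atMost d 0) (none d) ⟩
  binom≤ d 0 + 0                                   ≡⟨ cong (_+ 0) (binom≤-zeroʳ d) ⟩
  1                                                ∎
  where
  open ≡-Reasoning
  none : ∀ d → sizeOf {d} (λ _ → false) ≡ 0
  none zero = refl
  none (suc d) = cong₂ _+_ (none d) (none d)
sizeOf-atMost (suc d) (suc s) =
  trans (cong₂ _+_ (sizeOf-atMost d (suc s)) (sizeOf-atMost d s)) (sym (binom≤-suc d s))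

binom≤≤2^d : ∀ d s → binom≤ d s ≤ 2 ^ d
binom≤≤2^d d s = subst (_≤ 2 ^ d) (sizeOf-atMost d s) (sizeOf≤2^d {d} (atMost s))

does-true : {P : Set} (P? : Dec P) → does P? ≡ true → P
does-true (yes p) _ = p

downClosure : (Fin a → Subset d) → Family d
downClosure A p = does (any? λ i → p ⊆? A i)

downClosure-closed : (A : Fin a → Subset d) → DownClosed (downClosure A)
downClosure-closed A p q p⊆q q↓ with any? (λ i → q ⊆? A i)
... | yes (i , q⊆A) = dec-true (any? λ i → p ⊆? A i) (i , ⊆-trans p⊆q q⊆A)

-- Sgall's bound.  Passing to down-closures preserves the hypothesis, and a set lying
-- in both down-closures has at most s elements.
cross-intersecting : {A : Fin a → Subset d} {B : Fin b → Subset d} →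
                     Injective _≡_ _≡_ A → Injective _≡_ _≡_ B →
                     (∀ i j → ∣ A i ∩ B j ∣ ≤ s) → a * b ≤ size s d
cross-intersecting {a = a} {d} {b} {s} {A} {B} A-inj B-inj A∩B≤s = begin
  a * b                                                 ≤⟨ *-mono-≤ (a≤ A A-inj) (a≤ B B-inj) ⟩
  sizeOf (downClosure A) * sizeOf (downClosure B)       ≤⟨ sizeOf-⊓ _ _ (downClosure-closed A) (downClosure-closed B) ⟩
  2 ^ d * sizeOf (downClosure A ⊓ downClosure B)        ≤⟨ *-monoʳ-≤ (2 ^ d) (sizeOf-mono (downClosure A ⊓ downClosure B) (atMost s) both) ⟩
  2 ^ d * sizeOf {d} (atMost s)                         ≡⟨ cong (2 ^ d *_) (sizeOf-atMost d s) ⟩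
  2 ^ d * binom≤ d s                                    ≡⟨ *-comm (2 ^ d) _ ⟩
  size s d                                              ∎
  where
  open ≤-Reasoning
  a≤ : ∀ {a} (A : Fin a → Subset d) → Injective _≡_ _≡_ A → a ≤ sizeOf (downClosure A)
  a≤ A = injection⇒≤sizeOf (downClosure A) (λ i → dec-true (any? λ j → A i ⊆? A j) (i , ⊆-refl))
  both : (downClosure A ⊓ downClosure B) ⊑ atMost s
  both p e with any? (λ i → p ⊆? A i) | any? (λ j → p ⊆? B j)
  ... | yes (i , p⊆A) | yes (j , p⊆B) =
    dec-true (∣ p ∣ <? suc s) (s≤s $ ≤-trans (p⊆q⇒∣p∣≤∣q∣ (λ x∈p → x∈p∩q⁺ (p⊆A x∈p , p⊆B x∈p))) (A∩B≤s i j))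

-- Covers as labellings

infix 4 _≗₂_

_≗₂_ : Matrix n m → Matrix n m → Set
M ≗₂ N = ∀ i j → M i j ≡ N i j

∑-cong : {f g : Vector ℕ n} → f ≗ g → ∑ f ≡ ∑ g
∑-cong = Sum.sum-cong-≗ +-0-commutativeMonoid

[_] : Bool → ℕ
[ b ] = if b then 1 else 0

∑-positive⁺ : (f : Vector Bool n) → ∀ k → f k ≡ true → 1 ≤ ∑ ([_] ∘ f)
∑-positive⁺ f zero    fk rewrite fk = s≤s z≤n
∑-positive⁺ f (suc k) fk = ≤-trans (∑-positive⁺ (f ∘ suc) k fk) (m≤n+m _ [ f zero ])

∑-positive⁻ : (f : Vector Bool n) → 1 ≤ ∑ ([_] ∘ f) → ∃ λ k → f k ≡ true
∑-positive⁻ {suc n} f pos with f zero in eq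
... | true  = zero , eq
... | false = let k , fk = ∑-positive⁻ (f ∘ suc) pos in suc k , fk

∣∩∣≡∑ : (p q : Subset d) → ∣ p ∩ q ∣ ≡ ∑ λ k → [ lookup p k ∧ lookup q k ]
∣∩∣≡∑ []          []          = refl
∣∩∣≡∑ (false ∷ p) (_     ∷ q) = ∣∩∣≡∑ p q
∣∩∣≡∑ (true  ∷ p) (false ∷ q) = ∣∩∣≡∑ p q
∣∩∣≡∑ (true  ∷ p) (true  ∷ q) = cong suc (∣∩∣≡∑ p q)

∈?-lookup : (i : Fin n) (p : Subset n) → does (i ∈? p) ≡ lookup p i
∈?-lookup i p with i ∈? p
... | yes i∈p = sym ([]=⇒lookup i∈p)
... | no  i∉p with lookup p i in eq
...   | true  = contradiction (lookup⇒[]= i p eq) i∉p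
...   | false = refl

-- The three conditions on a cover, read as one condition on the number of rectangles through an
-- entry. Being monochromatic means that no rectangle passes through a zero.
Fits : ℕ → Bool → ℕ → Set
Fits s true  x = 1 ≤ x × x ≤ s
Fits s false x = x ≡ 0

fits? : ∀ s b x → Dec (Fits s b x)
fits? s true  x = (1 ≤? x) ×-dec (x ≤? s)
fits? s false x = x ≟ 0

Fits⇒≤ : ∀ b {x} → Fits s b x → x ≤ s
Fits⇒≤ true  (_ , x≤s) = x≤s
Fits⇒≤ false refl      = z≤n

-- Dually to a list of rectangles, label each row and each column with the set of
-- rectangles through it: an entry is covered as often as its two labels intersect.
Labelling : ℕ → Matrix n m → (Fin n → Subset d) → (Fin m → Subset d) → Set
Labelling s M A B = ∀ i j → Fits s (M i j) ∣ A i ∩ B j ∣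

Labelled : ℕ → Matrix n m → ℕ → Set
Labelled s M d = ∃ λ A → ∃ λ B → Labelling {d = d} s M A B

coverable⇒labelled : (M : Matrix n m) → Coverable s M d → Labelled s M d
coverable⇒labelled {s = s} {d = d} M (Rs , cover) = A , B , λ i j → subst (Fits s (M i j)) (sym (∩≡mult i j)) (fits i j)
  where
  open IsCover cover
  A = λ i → tabulate λ k → does (i ∈? rows (Rs k))
  B = λ j → tabulate λ k → does (j ∈? cols (Rs k))
  ∩≡mult : ∀ i j → ∣ A i ∩ B j ∣ ≡ multiplicity Rs i j
  ∩≡mult i j = trans (∣∩∣≡∑ (A i) (B j)) (∑-cong {d} λ k →
    cong₂ (λ x y → [ x ∧ y ]) (lookup∘tabulate (λ k → does (i ∈? rows (Rs k))) k)
                              (lookup∘tabulate (λ k → does (j ∈? cols (Rs k))) k))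
  fits : ∀ i j → Fits s (M i j) (multiplicity Rs i j)
  fits i j with M i j in eq
  ... | true  = covered i j eq , at-most i j eq
  ... | false = n<1⇒n≡0 (≰⇒> λ pos →
    let k , k∋ = ∑-positive⁻ (λ k → does (i , j ∈ᴿ? Rs k)) pos
    in contradiction (trans (sym eq) (monochromatic k i j (does-true (i , j ∈ᴿ? Rs k) k∋))) λ ())

labelled⇒coverable : (M : Matrix n m) → Labelled s M d → Coverable s M d
labelled⇒coverable {s = s} M (A , B , fits) = Rs , record
  { monochromatic = mono
  ; covered = λ i j eq → proj₁ (subst₂ (Fits s) eq (∩≡mult i j) (fits i j))
  ; at-most = λ i j eq → proj₂ (subst₂ (Fits s) eq (∩≡mult i j) (fits i j)) }
  where
  Rs : Vector (Rectangle _ _) _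
  Rs k = tabulate (λ i → lookup (A i) k) ⊠ tabulate (λ j → lookup (B j) k)
  ∈≡lookup : ∀ i j k → does (i , j ∈ᴿ? Rs k) ≡ lookup (A i) k ∧ lookup (B j) k
  ∈≡lookup i j k = cong₂ _∧_ (trans (∈?-lookup i _) (lookup∘tabulate _ i))
                             (trans (∈?-lookup j _) (lookup∘tabulate _ j))
  ∩≡mult : ∀ i j → ∣ A i ∩ B j ∣ ≡ multiplicity Rs i j
  ∩≡mult i j = trans (∣∩∣≡∑ (A i) (B j)) (∑-cong λ k → cong [_] (sym (∈≡lookup i j k)))
  mono : ∀ k i j → i , j ∈ᴿ Rs k → M i j ≡ true
  mono k i j ij∈ with M i j | fits i j
  ... | true  | _ = refl
  ... | false | z = contradiction
    (subst (1 ≤_) (trans (sym (∩≡mult i j)) z)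
      (∑-positive⁺ (λ k → does (i , j ∈ᴿ? Rs k)) k (dec-true (i , j ∈ᴿ? Rs k) ij∈))) λ ()

-- Pad with an empty rectangle.
labelled-suc : (M : Matrix n m) → Labelled s M d → Labelled s M (suc d)
labelled-suc M (A , B , fits) = (outside ∷_) ∘ A , (outside ∷_) ∘ B , fits

labelled-mono : (M : Matrix n m) → d ≤ e → Labelled s M d → Labelled s M e
labelled-mono {d = d} {e} M d≤e ℓ with d ≟ e
... | yes refl = ℓ
labelled-mono {d = d} {zero}  M z≤n ℓ | no 0≢0 = contradiction refl 0≢0
labelled-mono {d = d} {suc e} M d≤e ℓ | no d≢e = labelled-suc M (labelled-mono M (s≤s⁻¹ (≤∧≢⇒< d≤e d≢e)) ℓ)

labelled-cong : {M N : Matrix n m} → M ≗₂ N → Labelled s M d → Labelled s N d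
labelled-cong {s = s} M≗N (A , B , fits) = A , B , λ i j → subst (λ b → Fits s b _) (M≗N i j) (fits i j)

labelled-submatrix : (M : Matrix n m) (f : Fin a → Fin n) (g : Fin b → Fin m) →
                     Labelled s M d → Labelled s (λ i j → M (f i) (g j)) d
labelled-submatrix M f g (A , B , fits) = A ∘ f , B ∘ g , λ i j → fits (f i) (g j)

∣⊥∩_∣≡0 : (p : Subset d) → ∣ ⊥ ∩ p ∣ ≡ 0
∣⊥∩_∣≡0 {d} p = trans (cong ∣_∣ (∩-zeroˡ p)) (∣⊥∣≡0 d)

-- Withdraw row `i₀` from all old rectangles and cover its ones in `N` by a single new rectangle of
-- height one.
labelled-addRow : 1 ≤ s → (M N : Matrix n m) (i₀ : Fin n) → (∀ i j → i ≢ i₀ → M i j ≡ N i j) →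
                  Labelled s M d → Labelled s N (suc d)
labelled-addRow {s} {n} {m} {d} 1≤s M N i₀ M≗N (A , B , fits) = A′ , B′ , fits′
  where
  A′ : Fin n → Subset (suc d)
  A′ i = if does (i Finₚ.≟ i₀) then inside ∷ ⊥ else outside ∷ A i
  B′ : Fin m → Subset (suc d)
  B′ j = N i₀ j ∷ B j
  fits′ : Labelling s N A′ B′
  fits′ i j with i Finₚ.≟ i₀
  ... | no i≢i₀ = subst (λ b → Fits s b _) (M≗N i j i≢i₀) (fits i j)
  ... | yes refl with N i j
  ...   | true  = s≤s z≤n , subst (λ x → suc x ≤ s) (sym (∣⊥∩ B j ∣≡0)) 1≤s
  ...   | false = ∣⊥∩ B j ∣≡0

∣⁅_⁆∩_∣ : (i : Fin n) (p : Subset n) → ∣ ⁅ i ⁆ ∩ p ∣ ≡ [ lookup p i ]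
∣⁅ zero  ⁆∩ true  ∷ p ∣ = cong suc (∣⊥∩ p ∣≡0)
∣⁅ zero  ⁆∩ false ∷ p ∣ = ∣⊥∩ p ∣≡0
∣⁅ suc i ⁆∩ _     ∷ p ∣ = ∣⁅ i ⁆∩ p ∣

Fits-[] : 1 ≤ s → ∀ b → Fits s b [ b ]
Fits-[] 1≤s true  = s≤s z≤n , 1≤s
Fits-[] 1≤s false = refl

-- One rectangle per row: the row times the set of its ones.
labelled-rows : 1 ≤ s → (M : Matrix n m) → Labelled s M n
labelled-rows {s} 1≤s M = ⁅_⁆ , (λ j → tabulate λ i → M i j) , λ i j →
  subst (Fits s (M i j)) (sym (trans ∣⁅ i ⁆∩ tabulate _ ∣ (cong [_] (lookup∘tabulate _ i)))) (Fits-[] 1≤s (M i j))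

labelled-transpose : (M : Matrix n m) → Labelled s (flip M) d → Labelled s M d
labelled-transpose {s = s} M (A , B , fits) = B , A , λ i j →
  subst (λ p → Fits s (M i j) ∣ p ∣) (∩-comm (A j) (B i)) (fits j i)

labelled-cols : 1 ≤ s → (M : Matrix n m) → Labelled s M m
labelled-cols 1≤s M = labelled-transpose M (labelled-rows 1≤s (flip M))

-- A rectangle covers at most one diagonal entry of an identity block.
identity-block : (M : Matrix n m) (f : Fin a → Fin n) (g : Fin a → Fin m) →
                 (∀ i j → M (f i) (g j) ≡ does (i Finₚ.≟ j)) → Labelled s M d → a ≤ d
identity-block {s = s} M f g M≡1 (A , B , fits) = Finₚ.injective⇒≤ {f = κ} κ-injective
  where
  member : ∀ i → ∃ λ k → lookup (A (f i)) k ∧ lookup (B (g i)) k ≡ true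
  member i = ∑-positive⁻ _ $ subst (1 ≤_) (∣∩∣≡∑ (A (f i)) (B (g i)))
    (proj₁ (subst (λ b → Fits s b _) (trans (M≡1 i i) (dec-true (i Finₚ.≟ i) refl)) (fits (f i) (g i))))
  κ : Fin _ → Fin _
  κ i = proj₁ (member i)
  meet : ∀ {x y z w} → x ∧ y ≡ true → z ∧ w ≡ true → x ∧ w ≡ true
  meet {true} {true} {true} {true} _ _ = refl
  κ-injective : Injective _≡_ _≡_ κ
  κ-injective {i} {j} κi≡κj with i Finₚ.≟ j | M≡1 i j
  ... | yes i≡j | _ = i≡j
  -- A rectangle shared by the diagonal entries `i` and `j` would also contain the zero entry in row
  -- `f i` and column `g j`.
  ... | no  _   | Mij≡0 = contradiction (subst (1 ≤_) empty (∑-positive⁺ _ (κ i) shared)) λ ()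
    where
    shared : lookup (A (f i)) (κ i) ∧ lookup (B (g j)) (κ i) ≡ true
    shared = meet {lookup (A (f i)) (κ i)} (proj₂ (member i))
      (subst (λ k → lookup (A (f j)) k ∧ lookup (B (g j)) k ≡ true) (sym κi≡κj) (proj₂ (member j)))
    empty : ∑ (λ k → [ lookup (A (f i)) k ∧ lookup (B (g j)) k ]) ≡ 0
    empty = trans (sym (∣∩∣≡∑ (A (f i)) (B (g j)))) (subst (λ b → Fits s b _) Mij≡0 (fits (f i) (g j)))

-- Deciding the existence of labellings; labellings and binary rank

anyVec? : {S : Set} → (∀ {P : S → Set} → Decidable P → Dec (∃ P)) →
          ∀ {n} {P : Vec S n → Set} → Decidable P → Dec (∃ P)
anyVec? anyS? {zero}  P? = map′ ([] ,_) (λ { ([] , p) → p }) (P? [])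
anyVec? anyS? {suc n} P? = map′ (λ (x , v , p) → x ∷ v , p) (λ { (x ∷ v , p) → x , v , p })
  (anyS? λ x → anyVec? anyS? λ v → P? (x ∷ v))

labelled? : ∀ s (M : Matrix n m) d → Dec (Labelled s M d)
labelled? {n} {m} s M d = map′
  (λ (A , B , fits) → lookup A , lookup B , fits)
  (λ (A , B , fits) → tabulate A , tabulate B , λ i j →
    subst₂ (λ p q → Fits s (M i j) ∣ p ∩ q ∣)
      (sym (lookup∘tabulate A i)) (sym (lookup∘tabulate B j)) (fits i j))
  (anyVec? anySubset? {n} λ A → anyVec? anySubset? {m} λ B →
    all? λ i → all? λ j → fits? s (M i j) ∣ lookup A i ∩ lookup B j ∣)

atMost⇒labelled : (M : Matrix n m) → BinaryRankAtMost s d M → Labelled s M d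
atMost⇒labelled M (r , rank , r≤d) =
  labelled-mono M r≤d (coverable⇒labelled M (IsBinaryRank.coverable rank))

exactly⇒labelled : (M : Matrix n m) → BinaryRankExactly s d M → Labelled s M d
exactly⇒labelled M rank = coverable⇒labelled M (IsBinaryRank.coverable rank)

exactly⇒¬labelled : (M : Matrix n m) → BinaryRankExactly s (suc d) M → ¬ Labelled s M d
exactly⇒¬labelled M rank ℓ = 1+n≰n (IsBinaryRank.minimal rank _ (labelled⇒coverable M ℓ))

-- Coverability is monotone in the number of rectangles, so failure at `d` rules out every smaller
-- number too.
labelled⇒exactly : (M : Matrix n m) → Labelled s M (suc d) → ¬ Labelled s M d → BinaryRankExactly s (suc d) M
labelled⇒exactly M ℓ ¬ℓ = record
  { coverable = labelled⇒coverable M ℓ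
  ; minimal   = λ e c → ≰⇒> λ e≤d → ¬ℓ (labelled-mono M e≤d (coverable⇒labelled M c)) }

-- The property asks for the rank itself as a witness. It is found by descending from `d` as long as
-- one rectangle fewer still suffices.
labelled⇒atMost : (M : Matrix n m) → Labelled s M d → BinaryRankAtMost s d M
labelled⇒atMost {d = zero}  M ℓ =
  0 , record { coverable = labelled⇒coverable M ℓ ; minimal = λ _ _ → z≤n } , z≤n
labelled⇒atMost {s = s} {d = suc d} M ℓ with labelled? s M d
... | yes ℓ′ = let r , rank , r≤d = labelled⇒atMost M ℓ′ in r , rank , m≤n⇒m≤1+n r≤d
... | no ¬ℓ′ = suc d , labelled⇒exactly M ℓ ¬ℓ′ , ≤-refl

Distinct : Matrix n m → Set
Distinct M = ∀ i i′ → i ≢ i′ → ∃ λ j → M i j ≢ M i′ j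

-- Distinct rows of M have distinct labels.
distinct⇒area≤size : (M : Matrix n m) → Distinct M → Distinct (flip M) → Labelled s M d → n * m ≤ size s d
distinct⇒area≤size {n} {m} {s} {d} M rows≢ cols≢ (A , B , fits) =
  cross-intersecting {A = A} {B} A-inj B-inj (λ i j → Fits⇒≤ (M i j) (fits i j))
  where
  -- The size of the intersection determines the entry, so equal labels force equal rows or columns.
  fits-unique : ∀ b b′ {x} → Fits s b x → Fits s b′ x → b ≡ b′
  fits-unique true  true  _           _           = refl
  fits-unique true  false (() , _)    refl
  fits-unique false true  refl        (() , _)
  fits-unique false false _           _           = refl
  A-inj : Injective _≡_ _≡_ A
  A-inj {i} {i′} eq with i Finₚ.≟ i′
  ... | yes i≡i′ = i≡i′
  ... | no i≢i′ = let j , ≢ = rows≢ i i′ i≢i′ in contradiction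
    (fits-unique _ _ (fits i j) (subst (λ p → Fits s (M i′ j) ∣ p ∩ B j ∣) (sym eq) (fits i′ j))) ≢
  B-inj : Injective _≡_ _≡_ B
  B-inj {j} {j′} eq with j Finₚ.≟ j′
  ... | yes j≡j′ = j≡j′
  ... | no j≢j′ = let i , ≢ = cols≢ j j′ j≢j′ in contradiction
    (fits-unique _ _ (fits i j) (subst (λ p → Fits s (M i j′) ∣ A i ∩ p ∣) (sym eq) (fits i j′))) ≢

-- Distance, and matrices of rank exactly d near those of rank at most d

∑-mono : {f g : Vector ℕ n} → (∀ i → f i ≤ g i) → ∑ f ≤ ∑ g
∑-mono {zero}  f≤g = z≤n
∑-mono {suc n} f≤g = +-mono-≤ (f≤g zero) (∑-mono (f≤g ∘ suc))

∑-const : ∀ n c → ∑ {n} (λ _ → c) ≡ n * c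
∑-const zero    c = refl
∑-const (suc n) c = cong (c +_) (∑-const n c)

∑-*ˡ : ∀ c (f : Vector ℕ n) → ∑ (λ i → c * f i) ≡ c * ∑ f
∑-*ˡ {zero}  c f = sym (*-zeroʳ c)
∑-*ˡ {suc n} c f = trans (cong (c * f zero +_) (∑-*ˡ c (f ∘ suc))) (sym (*-distribˡ-+ c (f zero) _))

∑-*ʳ : ∀ c (f : Vector ℕ n) → ∑ (λ i → f i * c) ≡ ∑ f * c
∑-*ʳ c f = trans (∑-cong (λ i → *-comm (f i) c)) (trans (∑-*ˡ c f) (*-comm c (∑ f)))

∑-++ : ∀ a {b} (f : Vector ℕ (a + b)) → ∑ f ≡ ∑ (λ i → f (i ↑ˡ b)) + ∑ (λ j → f (a ↑ʳ j))
∑-++ zero    f = refl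
∑-++ (suc a) f = trans (cong (f zero +_) (∑-++ a (f ∘ suc))) (sym (+-assoc (f zero) _ _))

∑-combine : ∀ n m (f : Vector ℕ (n * m)) → ∑ {n} (λ i → ∑ λ j → f (combine i j)) ≡ ∑ f
∑-combine zero    m f = refl
∑-combine (suc n) m f = trans (cong (∑ (λ j → f (j ↑ˡ (n * m))) +_) (∑-combine n m (λ x → f (m ↑ʳ x)))) (sym (∑-++ m {n * m} f))

∑-[<] : ∀ n D → ∑ {n} (λ i → [ does (toℕ i <? D) ]) ≤ D
∑-[<] zero    D       = z≤n
∑-[<] (suc n) zero    = ≤-reflexive (trans (∑-const n 0) (*-zeroʳ n))
∑-[<] (suc n) (suc D) = s≤s (∑-[<] n D)

diff : Bool → Bool → ℕ
diff b c = if does (b ≟ᵇ c) then 0 else 1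

diff-refl : ∀ b → diff b b ≡ 0
diff-refl false = refl
diff-refl true  = refl

diff≤1 : ∀ b c → diff b c ≤ 1
diff≤1 false false = z≤n
diff≤1 false true  = ≤-refl
diff≤1 true  false = ≤-refl
diff≤1 true  true  = z≤n

diff-triangle : ∀ b c e → diff b e ≤ diff b c + diff c e
diff-triangle false false e     = ≤-refl
diff-triangle false true  false = z≤n
diff-triangle false true  true  = s≤s z≤n
diff-triangle true  true  e     = ≤-refl
diff-triangle true  false false = s≤s z≤n
diff-triangle true  false true  = z≤n

distance-cong : {M N : Matrix n m} → M ≗₂ N → distance M N ≡ 0
distance-cong {n} {m} {M} {N} M≗N = trans
  (∑-cong λ i → trans (∑-cong λ j → trans (cong (diff (M i j)) (sym (M≗N i j))) (diff-refl (M i j)))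
                      (trans (∑-const m 0) (*-zeroʳ m)))
  (trans (∑-const n 0) (*-zeroʳ n))

distance-triangle : (L M N : Matrix n m) → distance L N ≤ distance L M + distance M N
distance-triangle {n} {m} L M N = begin
  distance L N
    ≤⟨ ∑-mono (λ i → ∑-mono λ j → diff-triangle (L i j) (M i j) (N i j)) ⟩
  ∑ (λ i → ∑ λ j → diff (L i j) (M i j) + diff (M i j) (N i j))
    ≡⟨ ∑-cong (λ i → ∑-distrib-+ (λ j → diff (L i j) (M i j)) (λ j → diff (M i j) (N i j))) ⟩
  ∑ (λ i → ∑ (λ j → diff (L i j) (M i j)) + ∑ (λ j → diff (M i j) (N i j)))
    ≡⟨ ∑-distrib-+ (λ i → ∑ λ j → diff (L i j) (M i j)) (λ i → ∑ λ j → diff (M i j) (N i j)) ⟩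
  distance L M + distance M N ∎
  where open ≤-Reasoning

-- Planting an identity block row by row raises the rank by at most one per row and ends
-- at rank at least D, so it passes through rank exactly D.
plant : ℕ → ℕ → Matrix n m → Matrix n m
plant D k M i j = if does (toℕ i <? k) ∧ does (toℕ j <? D) then does (toℕ i ≟ toℕ j) else M i j

-- All changes lie in the top left `D` by `D` corner. Its indicator is a product, so the double sum
-- factors.
distance-plant : ∀ D (M : Matrix n m) {k} → k ≤ D → distance M (plant D k M) ≤ D * D
distance-plant {n} {m} D M {k} k≤D = begin
  distance M (plant D k M)
    ≤⟨ ∑-mono (λ i → ∑-mono λ j → block i j) ⟩
  ∑ {n} (λ i → ∑ {m} λ j → [ does (toℕ i <? D) ] * [ does (toℕ j <? D) ])
    ≡⟨ ∑-cong {n} (λ i → ∑-*ˡ [ does (toℕ i <? D) ] (λ j → [ does (toℕ {m} j <? D) ])) ⟩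
  ∑ {n} (λ i → [ does (toℕ i <? D) ] * ∑ {m} λ j → [ does (toℕ j <? D) ])
    ≡⟨ ∑-*ʳ (∑ {m} λ j → [ does (toℕ j <? D) ]) (λ i → [ does (toℕ {n} i <? D) ]) ⟩
  ∑ {n} (λ i → [ does (toℕ i <? D) ]) * ∑ {m} (λ j → [ does (toℕ j <? D) ])
    ≤⟨ *-mono-≤ (∑-[<] n D) (∑-[<] m D) ⟩
  D * D ∎
  where
  open ≤-Reasoning
  block′ : ∀ {P P′ Q : Set} (P? : Dec P) (P′? : Dec P′) (Q? : Dec Q) → (P → P′) → ∀ b c →
           diff b (if does P? ∧ does Q? then c else b) ≤ [ does P′? ] * [ does Q? ]
  block′ (no _)  _         _       _    b c = ≤-trans (≤-reflexive (diff-refl b)) z≤n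
  block′ (yes _) _         (no _)  _    b c = ≤-trans (≤-reflexive (diff-refl b)) z≤n
  block′ (yes _) (yes _)   (yes _) _    b c = diff≤1 b c
  block′ (yes p) (no ¬p′)  (yes _) P⇒P′ b c = contradiction (P⇒P′ p) ¬p′
  block : ∀ i j → diff (M i j) (plant D k M i j) ≤ [ does (toℕ i <? D) ] * [ does (toℕ j <? D) ]
  block i j = block′ (toℕ i <? k) (toℕ i <? D) (toℕ j <? D) (λ i<k → <-≤-trans i<k k≤D) (M i j) _

exactly-nearby : 1 ≤ s → suc d ≤ n → suc d ≤ m → (M : Matrix n m) → Labelled s M (suc d) →
                 ∃ λ N → BinaryRankExactly s (suc d) N × distance M N ≤ suc d * suc d
exactly-nearby {s} {d} {n} {m} 1≤s D≤n D≤m M ℓ with labelled? s M d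
... | no ¬ℓ  = M , labelled⇒exactly M ℓ ¬ℓ , ≤-trans (≤-reflexive (distance-cong {M = M} λ _ _ → refl)) z≤n
... | yes ℓ′ = search (suc d) 0 refl (labelled-cong (λ _ _ → refl) ℓ′)
  where
  D : ℕ
  D = suc d
  unplanted : ∀ k (k<n : k < n) i j → i ≢ fromℕ< k<n → plant D k M i j ≡ plant D (suc k) M i j
  unplanted k k<n i j i≢k = cong (λ b → if b ∧ does (toℕ j <? D) then does (toℕ i ≟ toℕ j) else M i j)
    (does-⇔ (mk⇔ m<n⇒m<1+n λ i<1+k → ≤∧≢⇒< (s≤s⁻¹ i<1+k) λ i≡k →
      i≢k (Finₚ.toℕ-injective (trans i≡k (sym (Finₚ.toℕ-fromℕ< k<n))))) (toℕ i <? k) (toℕ i <? suc k))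
  identity : ∀ i j → plant D D M (inject≤ i D≤n) (inject≤ j D≤m) ≡ does (i Finₚ.≟ j)
  identity i j = trans
    (cong₂ (λ x y → if x ∧ y then does (toℕ (inject≤ i D≤n) ≟ toℕ (inject≤ j D≤m)) else M (inject≤ i D≤n) (inject≤ j D≤m))
      (dec-true (toℕ (inject≤ i D≤n) <? D) (small i D≤n)) (dec-true (toℕ (inject≤ j D≤m) <? D) (small j D≤m)))
    (does-⇔ (mk⇔ (λ eq → Finₚ.inject≤-injective _ _ i j (Finₚ.toℕ-injective (trans eq (same j)))) λ { refl → sym (same i) })
      (toℕ (inject≤ i D≤n) ≟ toℕ (inject≤ j D≤m)) (i Finₚ.≟ j))
    where
    small : ∀ {k} (i : Fin D) (D≤k : D ≤ k) → toℕ (inject≤ i D≤k) < D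
    small i D≤k = subst (_< D) (sym (Finₚ.toℕ-inject≤ i D≤k)) (Finₚ.toℕ<n i)
    same : ∀ j → toℕ (inject≤ j D≤m) ≡ toℕ (inject≤ j D≤n)
    same j = trans (Finₚ.toℕ-inject≤ j D≤m) (sym (Finₚ.toℕ-inject≤ j D≤n))
  search : ∀ r k → k + r ≡ D → Labelled s (plant D k M) d →
           ∃ λ N → BinaryRankExactly s D N × distance M N ≤ D * D
  search zero k eq ℓ with refl ← trans (sym (+-identityʳ k)) eq =
    -- All `suc d` rows are planted, yet `d` rectangles would still suffice.
    contradiction (identity-block (plant D D M) (λ i → inject≤ i D≤n) (λ j → inject≤ j D≤m) identity ℓ) 1+n≰n
  search (suc r) k eq ℓ with labelled? s (plant D (suc k) M) d
  ... | yes ℓ′ = search r (suc k) (trans (sym (+-suc k r)) eq) ℓ′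
  -- The first planted row after which `d` rectangles are too few: one more suffices, as only row
  -- `k` has changed.
  ... | no ¬ℓ  = plant D (suc k) M
    , labelled⇒exactly _ (labelled-addRow 1≤s (plant D k M) _ (fromℕ< k<n) (unplanted k k<n) ℓ) ¬ℓ
    , distance-plant D M k<D
    where
    k<D : k < D
    k<D = subst (k <_) eq (m<m+n k (s≤s z≤n))
    k<n : k < n
    k<n = ≤-trans k<D D≤n

-- Repeated random trials

-- Here `e` stands for queries already made; `e ≤ B` settles the empty maximum, which is 0.
maximum-≤ : ∀ {B} e (f : Vector ℕ n) → e ≤ B → (∀ x → e + f x ≤ B) → e + maximum f ≤ B
maximum-≤ {zero}  e f e≤ f≤ = subst (_≤ _) (sym (+-identityʳ e)) e≤
maximum-≤ {suc n} e f e≤ f≤ = subst (_≤ _) (sym (+-distribˡ-⊔ e (f zero) _))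
  (⊔-lub (f≤ zero) (maximum-≤ e (f ∘ suc) e≤ (f≤ ∘ suc)))

≤ℚ-respˡ : ∀ {p q r} → p ≡ q → p ℚ.≤ r → q ℚ.≤ r
≤ℚ-respˡ refl p≤r = p≤r

≤ℚ-respʳ : ∀ {p q r} → p ≡ q → r ℚ.≤ p → r ℚ.≤ q
≤ℚ-respʳ refl r≤p = r≤p

0≤1 : 0ℚ ℚ.≤ 1ℚ
0≤1 = fromℕ-mono-≤ {0} {1} z≤n

Pr≤1 : (A : Algorithm n m) (M : Matrix n m) → Pr v A M ℚ.≤ 1ℚ
Pr≤1 {v = accept} (output accept) M = ℚ.≤-refl
Pr≤1 {v = accept} (output reject) M = 0≤1
Pr≤1 {v = reject} (output accept) M = 0≤1
Pr≤1 {v = reject} (output reject) M = ℚ.≤-refl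
Pr≤1 (query i j A) M = Pr≤1 (A (M i j)) M
Pr≤1 (random k A)  M = average-≤-const k λ x → Pr≤1 (A x) M

Pr-complement : (A : Algorithm n m) (M : Matrix n m) → Pr accept A M ℚ.+ Pr reject A M ≡ 1ℚ
Pr-complement (output accept) M = refl
Pr-complement (output reject) M = refl
Pr-complement (query i j A) M = Pr-complement (A (M i j)) M
Pr-complement (random k A)  M = begin
  i ℚ.* ∑ℚ p ℚ.+ i ℚ.* ∑ℚ q          ≡⟨ ℚ.*-distribˡ-+ i (∑ℚ p) (∑ℚ q) ⟨
  i ℚ.* (∑ℚ p ℚ.+ ∑ℚ q)              ≡⟨ cong (i ℚ.*_) (∑ℚ-+ p q) ⟨
  average k (λ x → p x ℚ.+ q x)      ≡⟨ average-const k (λ x → Pr-complement (A x) M) ⟩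
  1ℚ                                 ∎
  where
  open ≡-Reasoning
  i = ℤ.+ 1 ℚ./ k
  p = λ x → Pr accept (A x) M
  q = λ x → Pr reject (A x) M

queryAll : ∀ c → Vector (Fin n × Fin m) c → (Vector Bool c → Algorithm n m) → Algorithm n m
queryAll zero    cells A = A []ᶠ
queryAll (suc c) cells A =
  uncurry query (cells zero) λ b → queryAll c (cells ∘ suc) λ r → A (b ∷ᶠ r)

answers : Matrix n m → Vector (Fin n × Fin m) k → Vector Bool k
answers {k = zero}  M cells = []ᶠ
answers {k = suc c} M cells = uncurry M (cells zero) ∷ᶠ answers M (cells ∘ suc)

answers-lookup : (M : Matrix n m) (cells : Vector (Fin n × Fin m) k) →
                 ∀ x → answers M cells x ≡ uncurry M (cells x)
answers-lookup {k = suc c} M cells zero    = refl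
answers-lookup {k = suc c} M cells (suc x) = answers-lookup M (cells ∘ suc) x

Pr-queryAll : ∀ c (cells : Vector (Fin n × Fin m) c) A (M : Matrix n m) →
              Pr v (queryAll c cells A) M ≡ Pr v (A (answers M cells)) M
Pr-queryAll zero    cells A M = refl
Pr-queryAll (suc c) cells A M = Pr-queryAll c (cells ∘ suc) _ M

queries-queryAll : ∀ c (cells : Vector (Fin n × Fin m) c) A (M : Matrix n m) →
                   queries (queryAll c cells A) M ≡ c + queries (A (answers M cells)) M
queries-queryAll zero    cells A M = refl
queries-queryAll (suc c) cells A M = cong suc (queries-queryAll c (cells ∘ suc) _ M)

-- One round of sampling: a uniform choice fixes the cells to query, and the answers either yield a
-- new state (`just`, a hit) or nothing (a miss).
record Trial (n m : ℕ) (S : Set) : Set where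
  field
    choices : ℕ
    .{{choices≢0}} : NonZero choices
    cost    : ℕ
    cells   : Fin choices → Vector (Fin n × Fin m) cost
    decide  : Fin choices → Vector Bool cost → Maybe S

open Trial

phase : Trial n m S → ℕ → (S → Algorithm n m) → Algorithm n m → Algorithm n m
phase τ zero    succ fail = fail
phase τ (suc t) succ fail = random (choices τ) λ x → queryAll (cost τ) (cells τ x) λ r →
  maybe′ succ (phase τ t succ fail) (decide τ x r)

outcome : (τ : Trial n m S) → Matrix n m → Fin (choices τ) → Maybe S
outcome τ M x = decide τ x (answers M (cells τ x))

miss hit : Maybe S → ℕ
miss (just _) = 0
miss nothing  = 1
hit  (just _) = 1
hit  nothing  = 0

module _ (M : Matrix n m) (τ : Trial n m S) {succ : S → Algorithm n m} {fail : Algorithm n m} where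

  private
    Q = λ A → queries A M

  phase-≡1 : ∀ t → (∀ x σ → outcome τ M x ≡ just σ → Pr accept (succ σ) M ≡ 1ℚ) →
             Pr accept fail M ≡ 1ℚ → Pr accept (phase τ t succ fail) M ≡ 1ℚ
  phase-≡1 zero    succ≡ fail≡ = fail≡
  phase-≡1 (suc t) succ≡ fail≡ = average-const (choices τ) λ x →
    trans (Pr-queryAll (cost τ) (cells τ x) _ M) (branch x (outcome τ M x) refl)
    where
    branch : ∀ x o → outcome τ M x ≡ o → Pr accept (maybe′ succ (phase τ t succ fail) o) M ≡ 1ℚ
    branch x (just σ) eq = succ≡ x σ eq
    branch x nothing  eq = phase-≡1 t succ≡ fail≡

  phase-≤ : ∀ t {α} → (∀ x σ → outcome τ M x ≡ just σ → Pr accept (succ σ) M ℚ.≤ α) →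
            Pr accept fail M ℚ.≤ α → Pr accept (phase τ t succ fail) M ℚ.≤ α
  phase-≤ zero    succ≤ fail≤ = fail≤
  phase-≤ (suc t) {α} succ≤ fail≤ = average-≤-const (choices τ) λ x →
    ≤ℚ-respˡ (sym (Pr-queryAll (cost τ) (cells τ x) _ M)) (branch x (outcome τ M x) refl)
    where
    branch : ∀ x o → outcome τ M x ≡ o → Pr accept (maybe′ succ (phase τ t succ fail) o) M ℚ.≤ α
    branch x (just σ) eq = succ≤ x σ eq
    branch x nothing  eq = phase-≤ t succ≤ fail≤

  -- Only `t` misses in a row lead to `fail`, where acceptance is bounded merely by 1; this happens
  -- with probability at most (w/(1+w))^t. After a hit, acceptance is at most `α`.
  phase-detects : ∀ w t {α} → 0ℚ ℚ.≤ α →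
                  (∀ x σ → outcome τ M x ≡ just σ → Pr accept (succ σ) M ℚ.≤ α) →
                  ∑ (miss ∘ outcome τ M) * suc w ≤ w * choices τ →
                  Pr accept (phase τ t succ fail) M ℚ.≤ α ℚ.+ (ℤ.+ w ℚ./ suc w) ^ℚ t
  phase-detects w zero {α} 0≤α succ≤ miss≤ = ℚ.≤-trans (Pr≤1 fail M)
    (≤ℚ-respˡ (ℚ.+-identityˡ 1ℚ) (ℚ.+-monoˡ-≤ 1ℚ 0≤α))
  phase-detects w (suc t) {α} 0≤α succ≤ miss≤ =
    average-≤ (choices τ) {α} {β} w (miss ∘ outcome τ M) (^ℚ-nonNeg (0≤frac w) t) (λ x →
      ≤ℚ-respˡ (sym (Pr-queryAll (cost τ) (cells τ x) _ M)) (branch x (outcome τ M x) refl)) miss≤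
    where
    β = (ℤ.+ w ℚ./ suc w) ^ℚ t
    branch : ∀ x o → outcome τ M x ≡ o →
             Pr accept (maybe′ succ (phase τ t succ fail) o) M ℚ.≤ α ℚ.+ β ℚ.* fromℕ (miss o)
    branch x (just σ) eq = ≤ℚ-respʳ
      (sym (trans (cong (α ℚ.+_) (ℚ.*-zeroʳ β)) (ℚ.+-identityʳ α))) (succ≤ x σ eq)
    branch x nothing  eq = ≤ℚ-respʳ (sym (cong (α ℚ.+_) (ℚ.*-identityʳ β)))
      (phase-detects w t 0≤α succ≤ miss≤)

  -- A hit is charged for all `t` trials, however early it comes; `e` carries the cost of what
  -- precedes the phase.
  phase-queries : ∀ {B} t e → (∀ x σ → outcome τ M x ≡ just σ → e + t * cost τ + Q (succ σ) ≤ B) →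
                  e + t * cost τ + Q fail ≤ B → e + Q (phase τ t succ fail) ≤ B
  phase-queries zero    e succ≤ fail≤ = subst (λ x → x + Q fail ≤ _) (+-identityʳ e) fail≤
  phase-queries {B} (suc t) e succ≤ fail≤ = maximum-≤ e _ e≤B λ x →
    subst (_≤ B) (trans (+-assoc e (cost τ) _) (cong (e +_) (sym (queries-queryAll (cost τ) (cells τ x) _ M))))
      (branch x (outcome τ M x) refl)
    where
    e≤B : e ≤ B
    e≤B = ≤-trans (m≤m+n e _) (≤-trans (m≤m+n _ (Q fail)) fail≤)
    shift : ∀ y → e + (cost τ + t * cost τ) + y ≡ e + cost τ + t * cost τ + y
    shift y = cong (_+ y) (sym (+-assoc e (cost τ) (t * cost τ)))
    branch : ∀ x o → outcome τ M x ≡ o → e + cost τ + Q (maybe′ succ (phase τ t succ fail) o) ≤ B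
    branch x (just σ) eq = ≤-trans (+-monoˡ-≤ (Q (succ σ)) (+-monoʳ-≤ e (m≤m+n (cost τ) (t * cost τ))))
      (succ≤ x σ eq)
    branch x nothing  eq = phase-queries t (e + cost τ)
      (λ x σ eq → subst (_≤ B) (shift (Q (succ σ))) (succ≤ x σ eq)) (subst (_≤ B) (shift (Q fail)) fail≤)

-- T records the answers received on X × Y, so that they need not be queried again.
record Probe (n m : ℕ) : Set where
  constructor probe
  field
    {height-1 width-1} : ℕ
    X : Vector (Fin n) (suc height-1)
    Y : Vector (Fin m) (suc width-1)
    T : Matrix (suc height-1) (suc width-1)

  height width area : ℕ
  height = suc height-1
  width  = suc width-1
  area   = height * width

open Probe

-- Trials that enlarge a probe

match? : (r : Vector Bool b) (T : Matrix a b) → Dec (∃ λ i → ∀ j → r j ≡ T i j)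
match? r T = any? λ i → all? λ j → r j ≟ᵇ T i j

ifNo : {P : Set} → Dec P → S → Maybe S
ifNo (yes _) σ = nothing
ifNo (no  _) σ = just σ

ifNo-just : {P : Set} (P? : Dec P) {σ σ′ : S} → ifNo P? σ ≡ just σ′ → ¬ P × σ′ ≡ σ
ifNo-just (no ¬p) refl = ¬p , refl

ifNo-nothing : {P : Set} (P? : Dec P) {σ : S} → ifNo P? σ ≡ nothing → P
ifNo-nothing (yes p) _ = p

-- An unfamiliar row or column counts as a miss here: finding those is left to the row and column
-- trials.
ifMismatch : {P : Fin a → Set} {Q : Fin b → Set} → Dec (∃ P) → Dec (∃ Q) →
             Bool → Matrix a b → S → Maybe S
ifMismatch (yes (i , _)) (yes (j , _)) v T = ifNo (v ≟ᵇ T i j)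
ifMismatch (yes _)       (no  _)       v T σ = nothing
ifMismatch (no  _)       _             v T σ = nothing

ifMismatch-just : {P : Fin a → Set} {Q : Fin b → Set} (P? : Dec (∃ P)) (Q? : Dec (∃ Q)) →
                  ∀ {v T} {σ σ′ : S} → ifMismatch P? Q? v T σ ≡ just σ′ →
                  (∃ λ i → ∃ λ j → P i × Q j × v ≢ T i j) × σ′ ≡ σ
ifMismatch-just (yes (i , p)) (yes (j , q)) {v} {T} eq =
  let v≢ , σ′≡ = ifNo-just (v ≟ᵇ T i j) eq in (i , j , p , q , v≢) , σ′≡

ifMismatch-nothing : {P : Fin a → Set} {Q : Fin b → Set} (P? : Dec (∃ P)) (Q? : Dec (∃ Q)) →
                     ∀ {v T} {σ : S} → ifMismatch P? Q? v T σ ≡ nothing → ∃ P → ∃ Q →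
                     ∃ λ i → ∃ λ j → P i × Q j × v ≡ T i j
ifMismatch-nothing (yes (i , p)) (yes (j , q)) {v} {T} eq _ _ =
  i , j , p , q , ifNo-nothing (v ≟ᵇ T i j) eq
ifMismatch-nothing (no ¬p) _       eq p q = contradiction p ¬p
ifMismatch-nothing (yes _) (no ¬q) eq p q = contradiction q ¬q

addRow : (σ : Probe n m) → Fin n → Vector Bool (width σ) → Probe n m
addRow (probe X Y T) i r = probe (i ∷ᶠ X) Y (r ∷ᶠ T)

addCol : (σ : Probe n m) → Fin m → Vector Bool (height σ) → Probe n m
addCol (probe X Y T) j c = probe X (j ∷ᶠ Y) λ p → c p ∷ᶠ T p

addBoth : (σ : Probe n m) → Fin n → Fin m → Bool → Vector Bool (width σ) → Vector Bool (height σ) → Probe n m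
addBoth (probe X Y T) i j v r c = probe (i ∷ᶠ X) (j ∷ᶠ Y) ((v ∷ᶠ r) ∷ᶠ λ p → c p ∷ᶠ T p)

rowTrial : .{{_ : NonZero n}} → Probe n m → Trial n m (Probe n m)
rowTrial {n} σ = record
  { choices = n
  ; cost    = width σ
  ; cells   = λ i q → i , Y σ q
  ; decide  = λ i r → ifNo (match? r (T σ)) (addRow σ i r)
  }

colTrial : .{{_ : NonZero m}} → Probe n m → Trial n m (Probe n m)
colTrial {m} σ = record
  { choices = m
  ; cost    = height σ
  ; cells   = λ j p → X σ p , j
  ; decide  = λ j c → ifNo (match? c (flip (T σ))) (addCol σ j c)
  }

-- The queries are exactly the cells by which one new row and one new column enlarge the probe, so
-- the cost equals the gain in area.
entryTrial : .{{_ : NonZero (n * m)}} → Probe n m → Trial n m (Probe n m)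
entryTrial {n} {m} σ = record
  { choices = n * m
  ; cost    = suc (width σ + height σ)
  ; cells   = λ x → let i , j = remQuot m x in
                (i , j) ∷ᶠ ((λ q → i , Y σ q) ++ᶠ (λ p → X σ p , j))
  ; decide  = λ x u → let i , j = remQuot m x
                          r = λ (q : Fin (width σ)) → u (suc (q ↑ˡ height σ))
                          c = λ (p : Fin (height σ)) → u (suc (width σ ↑ʳ p))
                      in ifMismatch (match? r (T σ)) (match? c (flip (T σ))) (u zero) (T σ)
                           (addBoth σ i j (u zero) r c)
  }

distinct-suc : (T : Matrix (suc a) b) → Distinct (T ∘ suc) →
               (∀ i → ∃ λ j → T zero j ≢ T (suc i) j) → Distinct T
distinct-suc T T≢ new zero    zero     i≢ = contradiction refl i≢
distinct-suc T T≢ new zero    (suc i′) i≢ = new i′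
distinct-suc T T≢ new (suc i) zero     i≢ = let j , ≢ = new i in j , ≢ ∘ sym
distinct-suc T T≢ new (suc i) (suc i′) i≢ = T≢ i i′ (i≢ ∘ cong suc)

distinct-wider : (T : Matrix a (suc b)) → Distinct (λ i j → T i (suc j)) → Distinct T
distinct-wider T T≢ i i′ i≢ = let j , ≢ = T≢ i i′ i≢ in suc j , ≢

unmatched : (r : Vector Bool b) (T : Matrix a b) → ¬ (∃ λ i → ∀ j → r j ≡ T i j) →
            ∀ i → ∃ λ j → r j ≢ T i j
unmatched r T ¬match i = Finₚ.¬∀⟶∃¬ _ _ (λ j → r j ≟ᵇ T i j) (λ r≗ → ¬match (i , r≗))

-- The invariant of the search. Distinctness of rows and columns is what lets Sgall's bound limit
-- the area.
record Sound (M : Matrix n m) (σ : Probe n m) : Set where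
  field
    agree : ∀ p q → T σ p q ≡ M (X σ p) (Y σ q)
    rows≢ : Distinct (T σ)
    cols≢ : Distinct (flip (T σ))

open Sound

module _ (M : Matrix n m) (σ : Probe n m) where

  addRow-sound : ∀ i r → Sound M σ → (∀ q → r q ≡ M i (Y σ q)) →
                 ¬ (∃ λ p → ∀ q → r q ≡ T σ p q) → Sound M (addRow σ i r)
  addRow-sound i r snd r≗ new = record
    { agree = λ { zero q → r≗ q ; (suc p) q → agree snd p q }
    ; rows≢ = distinct-suc _ (rows≢ snd) (unmatched r (T σ) new)
    ; cols≢ = distinct-wider _ (cols≢ snd)
    }

  addCol-sound : ∀ j c → Sound M σ → (∀ p → c p ≡ M (X σ p) j) →
                 ¬ (∃ λ q → ∀ p → c p ≡ T σ p q) → Sound M (addCol σ j c)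
  addCol-sound j c snd c≗ new = record
    { agree = λ { p zero → c≗ p ; p (suc q) → agree snd p q }
    ; rows≢ = distinct-wider _ (rows≢ snd)
    ; cols≢ = distinct-suc _ (cols≢ snd) (unmatched c (flip (T σ)) new)
    }

  -- Row i looks like row p of the probe and column j like column q.  As the entry (i , j)
  -- differs from (p , q), column j tells i from every row that looks like it, and row i
  -- tells j from every column that looks like it.
  addBoth-sound : ∀ i j v r c → Sound M σ → v ≡ M i j → (∀ q → r q ≡ M i (Y σ q)) → (∀ p → c p ≡ M (X σ p) j) →
                  ∀ p q → (∀ y → r y ≡ T σ p y) → (∀ x → c x ≡ T σ x q) → v ≢ T σ p q →
                  Sound M (addBoth σ i j v r c)
  addBoth-sound i j v r c snd v≡ r≗ c≗ p q r~p c~q v≢ = record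
    { agree = λ { zero zero → v≡ ; zero (suc y) → r≗ y ; (suc x) zero → c≗ x ; (suc x) (suc y) → agree snd x y }
    ; rows≢ = distinct-suc _ (distinct-wider _ (rows≢ snd)) newRow
    ; cols≢ = distinct-suc _ (distinct-wider _ (cols≢ snd)) newCol
    }
    where
    newRow : ∀ x → ∃ λ y → (v ∷ᶠ r) y ≢ (c x ∷ᶠ T σ x) y
    newRow x with all? (λ y → r y ≟ᵇ T σ x y)
    ... | yes r~x = zero , λ v≡cx → v≢ (trans v≡cx (trans (c~q x) (trans (sym (r~x q)) (r~p q))))
    ... | no ¬r~x = let y , ≢ = Finₚ.¬∀⟶∃¬ _ _ (λ y → r y ≟ᵇ T σ x y) ¬r~x in suc y , ≢
    T′ = T (addBoth σ i j v r c)
    newCol : ∀ y → ∃ λ x → T′ x zero ≢ T′ x (suc y)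
    newCol y with all? (λ x → c x ≟ᵇ T σ x y)
    ... | yes c~y = zero , λ v≡ry → v≢ (trans v≡ry (trans (r~p y) (trans (sym (c~y p)) (c~q p))))
    ... | no ¬c~y = let x , ≢ = Finₚ.¬∀⟶∃¬ _ _ (λ x → c x ≟ᵇ T σ x y) ¬c~y in suc x , ≢

  RowMatch : Fin n → Set
  RowMatch i = ∃ λ p → ∀ q → M i (Y σ q) ≡ T σ p q

  ColMatch : Fin m → Set
  ColMatch j = ∃ λ q → ∀ p → M (X σ p) j ≡ T σ p q

  EntryMatch : Fin n → Fin m → Set
  EntryMatch i j = ∃ λ p → ∃ λ q →
    (∀ y → M i (Y σ y) ≡ T σ p y) × (∀ x → M (X σ x) j ≡ T σ x q) × M i j ≡ T σ p q

  module _ .{{_ : NonZero n}} where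

    rowTrial-sound : Sound M σ → ∀ i {σ′} → outcome (rowTrial σ) M i ≡ just σ′ → Sound M σ′
    rowTrial-sound snd i eq with new , refl ← ifNo-just (match? (answers M (cells (rowTrial σ) i)) (T σ)) eq =
      addRow-sound i _ snd (answers-lookup M (cells (rowTrial σ) i)) new

    rowTrial-area : ∀ i {σ′} → outcome (rowTrial σ) M i ≡ just σ′ → area σ′ ≡ width σ + area σ
    rowTrial-area i eq with _ , refl ← ifNo-just (match? (answers M (cells (rowTrial σ) i)) (T σ)) eq = refl

    rowTrial-nothing : ∀ i → outcome (rowTrial σ) M i ≡ nothing → RowMatch i
    rowTrial-nothing i eq =
      let p , r~ = ifNo-nothing (match? (answers M (cells (rowTrial σ) i)) (T σ)) eq
      in p , λ q → trans (sym (answers-lookup M (cells (rowTrial σ) i) q)) (r~ q)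

  module _ .{{_ : NonZero m}} where

    colTrial-sound : Sound M σ → ∀ j {σ′} → outcome (colTrial σ) M j ≡ just σ′ → Sound M σ′
    colTrial-sound snd j eq with new , refl ← ifNo-just (match? (answers M (cells (colTrial σ) j)) (flip (T σ))) eq =
      addCol-sound j _ snd (answers-lookup M (cells (colTrial σ) j)) new

    colTrial-area : ∀ j {σ′} → outcome (colTrial σ) M j ≡ just σ′ → area σ′ ≡ height σ + area σ
    colTrial-area j eq with _ , refl ← ifNo-just (match? (answers M (cells (colTrial σ) j)) (flip (T σ))) eq =
      *-suc (height σ) (width σ)

    colTrial-nothing : ∀ j → outcome (colTrial σ) M j ≡ nothing → ColMatch j
    colTrial-nothing j eq =
      let q , c~ = ifNo-nothing (match? (answers M (cells (colTrial σ) j)) (flip (T σ))) eq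
      in q , λ p → trans (sym (answers-lookup M (cells (colTrial σ) j) p)) (c~ p)

  module _ .{{_ : NonZero (n * m)}} (x : Fin (n * m)) where

    private
      i = proj₁ (remQuot {n} m x)
      j = proj₂ (remQuot {n} m x)
      cs = cells (entryTrial σ) x
      u = answers M cs
      r : Vector Bool (width σ)
      r q = u (suc (q ↑ˡ height σ))
      c : Vector Bool (height σ)
      c p = u (suc (width σ ↑ʳ p))
      row? = match? r (T σ)
      col? = match? c (flip (T σ))
      grown = addBoth σ i j (u zero) r c

      r≗ : ∀ q → r q ≡ M i (Y σ q)
      r≗ q = trans (answers-lookup M cs (suc (q ↑ˡ height σ)))
        (cong (uncurry M) (lookup-++ˡ (λ q → i , Y σ q) (λ p → X σ p , j) q))

      c≗ : ∀ p → c p ≡ M (X σ p) j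
      c≗ p = trans (answers-lookup M cs (suc (width σ ↑ʳ p)))
        (cong (uncurry M) (lookup-++ʳ (λ q → i , Y σ q) (λ p → X σ p , j) p))

    entryTrial-sound : Sound M σ → ∀ {σ′} → outcome (entryTrial σ) M x ≡ just σ′ → Sound M σ′
    entryTrial-sound snd eq with (p , q , r~ , c~ , v≢) , refl ← ifMismatch-just row? col? {u zero} {T σ} {grown} eq =
      addBoth-sound i j (u zero) r c snd refl r≗ c≗ p q r~ c~ v≢

    entryTrial-area : ∀ {σ′} → outcome (entryTrial σ) M x ≡ just σ′ →
                      area σ′ ≡ suc (width σ + height σ) + area σ
    entryTrial-area eq with _ , refl ← ifMismatch-just row? col? {u zero} {T σ} {grown} eq =
      trans (cong (suc (width σ) +_) (*-suc (height σ) (width σ))) (sym (+-assoc (suc (width σ)) (height σ) (area σ)))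

    entryTrial-nothing : outcome (entryTrial σ) M x ≡ nothing → RowMatch i → ColMatch j → EntryMatch i j
    entryTrial-nothing eq (p′ , r~′) (q′ , c~′) =
      let p , q , r~ , c~ , v≡ = ifMismatch-nothing row? col? {u zero} {T σ} {grown} eq
            (p′ , λ y → trans (r≗ y) (r~′ y)) (q′ , λ x → trans (c≗ x) (c~′ x))
      in p , q , (λ y → trans (sym (r≗ y)) (r~ y)) , (λ x → trans (sym (c≗ x)) (c~ x)) , v≡

-- The blow-up of a probe, and trials that detect its errors

pick : {P : Fin (suc a) → Set} → Dec (∃ P) → Fin (suc a)
pick (yes (i , _)) = i
-- An arbitrary default for unfamiliar rows and columns; all their entries are charged to hits of
-- the row and column trials.
pick (no _)        = zero

pick-correct : {P : Fin (suc a) → Set} (P? : Dec (∃ P)) → ∃ P → P (pick P?)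
pick-correct (yes (_ , p)) _ = p
pick-correct (no ¬p)       p = contradiction p ¬p

-- A trial misses with probability at most w/(1+w), so it hits with probability at least 1/(1+w).
Detects : ℕ → Matrix n m → Trial n m S → Set
Detects w M τ = ∑ (miss ∘ outcome τ M) * suc w ≤ w * choices τ

hits : Matrix n m → Trial n m S → ℕ
hits M τ = ∑ (hit ∘ outcome τ M)

often-hit⇒detects : ∀ w (M : Matrix n m) (τ : Trial n m S) → choices τ ≤ suc w * hits M τ → Detects w M τ
often-hit⇒detects w M τ often = begin
  misses * suc w            ≡⟨ *-suc misses w ⟩
  misses + misses * w       ≤⟨ +-monoˡ-≤ (misses * w) misses≤ ⟩
  w * h + misses * w        ≡⟨ solve 3 (λ w h k → w :* h :+ k :* w := w :* (k :+ h)) refl w h misses ⟩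
  w * (misses + h)          ≡⟨ cong (w *_) total ⟩
  w * choices τ             ∎
  where
  open ≤-Reasoning
  open +-*-Solver
  misses = ∑ (miss ∘ outcome τ M)
  h = hits M τ
  miss+hit : ∀ (o : Maybe _) → miss o + hit o ≡ 1
  miss+hit (just _) = refl
  miss+hit nothing  = refl
  total : misses + h ≡ choices τ
  total = trans (sym (∑-distrib-+ (miss ∘ outcome τ M) (hit ∘ outcome τ M)))
    (trans (∑-cong (miss+hit ∘ outcome τ M)) (trans (∑-const (choices τ) 1) (*-identityʳ (choices τ))))
  misses≤ : misses ≤ w * h
  misses≤ = +-cancelʳ-≤ h misses (w * h) $ begin
    misses + h      ≡⟨ total ⟩
    choices τ       ≤⟨ often ⟩
    h + w * h       ≡⟨ +-comm h (w * h) ⟩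
    w * h + h       ∎

module _ .{{n≢0 : NonZero n}} .{{m≢0 : NonZero m}} .{{nm≢0 : NonZero (n * m)}}
         {M : Matrix n m} {σ : Probe n m} (snd : Sound M σ) where

  private
    ρ : Fin n → Fin (height σ)
    ρ i = pick (match? (λ q → M i (Y σ q)) (T σ))

    κ : Fin m → Fin (width σ)
    κ j = pick (match? (λ p → M (X σ p) j) (flip (T σ)))

    U = hits M (rowTrial σ)
    W = hits M (colTrial σ)
    E = hits M (entryTrial σ)

  blowUp : Matrix n m
  blowUp i j = T σ (ρ i) (κ j)

  -- The trial may match `i` and `j` with a row and column other than `ρ i` and `κ j`. The values of
  -- `M` in row `i` on `Y`, then those in column `j` on `X`, lead from one pair to the other.
  entryMatch⇒≡ : ∀ i j → RowMatch M σ i → ColMatch M σ j → EntryMatch M σ i j → M i j ≡ blowUp i j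
  entryMatch⇒≡ i j row col (p , q , r~p , c~q , Mij≡) = begin
    M i j              ≡⟨ Mij≡ ⟩
    T σ p q            ≡⟨ r~p q ⟨
    M i (Y σ q)        ≡⟨ pick-correct (match? (λ q → M i (Y σ q)) (T σ)) row q ⟩
    T σ (ρ i) q        ≡⟨ c~q (ρ i) ⟨
    M (X σ (ρ i)) j    ≡⟨ pick-correct (match? (λ p → M (X σ p) j) (flip (T σ))) col (ρ i) ⟩
    T σ (ρ i) (κ j)    ∎
    where open ≡-Reasoning

  -- If all three trials miss, then row and column are familiar and the entry agrees with the
  -- blow-up; hence every wrong entry is charged to some hit.
  diff≤hits : ∀ i j → diff (M i j) (blowUp i j) ≤
    hit (outcome (rowTrial σ) M i) + hit (outcome (colTrial σ) M j) + hit (outcome (entryTrial σ) M (combine i j))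
  diff≤hits i j = bound _ _ _ λ row≡ col≡ entry≡ →
    let row = rowTrial-nothing M σ i row≡
        col = colTrial-nothing M σ j col≡
        Mij≡ = subst (λ (i , j) → RowMatch M σ i → ColMatch M σ j → EntryMatch M σ i j)
                 (Finₚ.remQuot-combine {n} i j) (entryTrial-nothing M σ (combine i j) entry≡) row col
    in trans (cong (diff (M i j)) (sym (entryMatch⇒≡ i j row col Mij≡))) (diff-refl (M i j))
    where
    bound : (o₁ o₂ o₃ : Maybe (Probe n m)) →
            (o₁ ≡ nothing → o₂ ≡ nothing → o₃ ≡ nothing → diff (M i j) (blowUp i j) ≡ 0) →
            diff (M i j) (blowUp i j) ≤ hit o₁ + hit o₂ + hit o₃
    bound nothing  nothing  nothing  eq = ≤-reflexive (eq refl refl refl)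
    bound (just _) _        _        eq = ≤-trans (diff≤1 (M i j) _) (s≤s z≤n)
    bound nothing  (just _) _        eq = ≤-trans (diff≤1 (M i j) _) (s≤s z≤n)
    bound nothing  nothing  (just _) eq = diff≤1 (M i j) _

  -- A hit in the row trial spoils the `m` entries of its row, one in the column trial the `n`
  -- entries of its column.
  distance≤hits : distance M blowUp ≤ m * U + n * W + E
  distance≤hits = begin
    distance M blowUp
      ≤⟨ ∑-mono (λ i → ∑-mono λ j → diff≤hits i j) ⟩
    ∑ (λ i → ∑ λ j → f i + g j + h (combine i j))
      ≡⟨ ∑-cong (λ i → trans (∑-distrib-+ (λ j → f i + g j) (λ j → h (combine i j)))
           (cong (_+ ∑ (λ j → h (combine i j))) (trans (∑-distrib-+ (λ _ → f i) g) (cong (_+ W) (∑-const m (f i)))))) ⟩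
    ∑ (λ i → m * f i + W + ∑ λ j → h (combine i j))
      ≡⟨ ∑-distrib-+ (λ i → m * f i + W) (λ i → ∑ λ j → h (combine i j)) ⟩
    ∑ (λ i → m * f i + W) + ∑ {n} (λ i → ∑ λ j → h (combine i j))
      ≡⟨ cong₂ _+_ (trans (∑-distrib-+ (λ i → m * f i) (λ _ → W)) (cong₂ _+_ (∑-*ˡ m f) (∑-const n W))) (∑-combine n m h) ⟩
    m * U + n * W + E ∎
    where
    open ≤-Reasoning
    f = hit ∘ outcome (rowTrial σ) M
    g = hit ∘ outcome (colTrial σ) M
    h = hit ∘ outcome (entryTrial σ) M

  -- If every kind of trial hit with probability at most 1/(3q), each would account for at most a
  -- third of nm/q wrong entries, too few for a far blow-up.
  far⇒detects : ∀ {w q} → suc w ≡ 3 * q → n * m < q * distance M blowUp →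
                Detects w M (rowTrial σ) ⊎ Detects w M (colTrial σ) ⊎ Detects w M (entryTrial σ)
  far⇒detects {w} {q} w≡ far
    with n ≤? suc w * U | m ≤? suc w * W | n * m ≤? suc w * E
  ... | yes p | _     | _     = inj₁ (often-hit⇒detects w M (rowTrial σ) p)
  ... | no _  | yes p | _     = inj₂ (inj₁ (often-hit⇒detects w M (colTrial σ) p))
  ... | no _  | no _  | yes p = inj₂ (inj₂ (often-hit⇒detects w M (entryTrial σ) p))
  ... | no ¬u | no ¬w | no ¬e = contradiction far (≤⇒≯ (*-cancelˡ-≤ 3 close))
    where
    open ≤-Reasoning
    open +-*-Solver
    close : 3 * (q * distance M blowUp) ≤ 3 * (n * m)
    close = begin
      3 * (q * distance M blowUp)                              ≡⟨ *-assoc 3 q _ ⟨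
      3 * q * distance M blowUp                                ≡⟨ cong (_* distance M blowUp) w≡ ⟨
      suc w * distance M blowUp                                ≤⟨ *-monoʳ-≤ (suc w) distance≤hits ⟩
      suc w * (m * U + n * W + E)                              ≡⟨ solve 6 (λ v m n U W E →
        v :* (m :* U :+ n :* W :+ E) := m :* (v :* U) :+ n :* (v :* W) :+ v :* E) refl (suc w) m n U W E ⟩
      m * (suc w * U) + n * (suc w * W) + suc w * E            ≤⟨ +-mono-≤ (+-mono-≤
        (*-monoʳ-≤ m (≰⇒≥ ¬u)) (*-monoʳ-≤ n (≰⇒≥ ¬w))) (≰⇒≥ ¬e) ⟩
      m * n + n * m + n * m                                    ≡⟨ solve 2 (λ m n →
        m :* n :+ n :* m :+ n :* m := con 3 :* (n :* m)) refl m n ⟩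
      3 * (n * m)                                              ∎

-- Cost and error of the adaptive search

gate : Dec P → Algorithm n m → Algorithm n m
gate (yes _) A = A
gate (no  _) A = output reject

gate-yes : (P? : Dec P) {A : Algorithm n m} → P → gate P? A ≡ A
gate-yes (yes _) p = refl
gate-yes (no ¬p) p = contradiction p ¬p

gate-elim : (R : Algorithm n m → Set) (P? : Dec P) {A : Algorithm n m} →
            (P → R A) → R (output reject) → R (gate P? A)
gate-elim R (yes p) RA R⊥ = RA p
gate-elim R (no _)  RA R⊥ = R⊥

module _ .{{n≢0 : NonZero n}} .{{m≢0 : NonZero m}} .{{nm≢0 : NonZero (n * m)}} where

  finalPhase : ℕ → Probe n m → (Probe n m → Algorithm n m) → Algorithm n m
  finalPhase t σ succ = phase (entryTrial σ) t succ (output accept)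

  -- The cheap trials enlarge the longer side and gain their own cost in area; after them
  -- the dear ones still cost at most twice what they gain.
  cheapFirst : (σ : Probe n m) → Dec (height σ ≤ width σ) → ℕ → (Probe n m → Algorithm n m) → Algorithm n m
  cheapFirst σ (yes _) t succ = phase (colTrial σ) t succ (phase (rowTrial σ) t succ (finalPhase t σ succ))
  cheapFirst σ (no  _) t succ = phase (rowTrial σ) t succ (phase (colTrial σ) t succ (finalPhase t σ succ))

  sweep : ℕ → Probe n m → (Probe n m → Algorithm n m) → Algorithm n m
  sweep t σ = cheapFirst σ (height σ ≤? width σ) t

  -- Every success enlarges the area, which stays at most size s d if the rank is at most d:
  -- then fuel size s d is never used up.
  run : (s d t fuel : ℕ) → Probe n m → Algorithm n m
  run s d t zero       σ = output reject
  run s d t (suc fuel) σ =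
    gate ((area σ ≤? size s d) ×-dec labelled? s (T σ) d) (sweep t σ (run s d t fuel))

  module _ (M : Matrix n m) (σ : Probe n m) where

    row-grows : Sound M σ → ∀ i σ′ → outcome (rowTrial σ) M i ≡ just σ′ → Sound M σ′ × suc (area σ) ≤ area σ′
    row-grows snd i σ′ eq = rowTrial-sound M σ snd i eq
      , subst (suc (area σ) ≤_) (sym (rowTrial-area M σ i eq)) (+-monoˡ-≤ (area σ) {1} {width σ} (s≤s z≤n))

    col-grows : Sound M σ → ∀ j σ′ → outcome (colTrial σ) M j ≡ just σ′ → Sound M σ′ × suc (area σ) ≤ area σ′
    col-grows snd j σ′ eq = colTrial-sound M σ snd j eq
      , subst (suc (area σ) ≤_) (sym (colTrial-area M σ j eq)) (+-monoˡ-≤ (area σ) {1} {height σ} (s≤s z≤n))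

    entry-grows : Sound M σ → ∀ x σ′ → outcome (entryTrial σ) M x ≡ just σ′ → Sound M σ′ × suc (area σ) ≤ area σ′
    entry-grows snd x σ′ eq = entryTrial-sound M σ x snd eq
      , subst (suc (area σ) ≤_) (sym (entryTrial-area M σ x eq)) (+-monoˡ-≤ (area σ) {1} {suc (width σ + height σ)} (s≤s z≤n))

    cheapFirst-≡1 : ∀ h≤w? t {succ} → Sound M σ →
                    (∀ σ′ → Sound M σ′ × suc (area σ) ≤ area σ′ → Pr accept (succ σ′) M ≡ 1ℚ) →
                    Pr accept (cheapFirst σ h≤w? t succ) M ≡ 1ℚ
    cheapFirst-≡1 (yes _) t snd ih =
      phase-≡1 M (colTrial σ) t (λ x σ′ eq → ih σ′ (col-grows snd x σ′ eq)) $
      phase-≡1 M (rowTrial σ) t (λ x σ′ eq → ih σ′ (row-grows snd x σ′ eq)) $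
      phase-≡1 M (entryTrial σ) t (λ x σ′ eq → ih σ′ (entry-grows snd x σ′ eq)) refl
    cheapFirst-≡1 (no _) t snd ih =
      phase-≡1 M (rowTrial σ) t (λ x σ′ eq → ih σ′ (row-grows snd x σ′ eq)) $
      phase-≡1 M (colTrial σ) t (λ x σ′ eq → ih σ′ (col-grows snd x σ′ eq)) $
      phase-≡1 M (entryTrial σ) t (λ x σ′ eq → ih σ′ (entry-grows snd x σ′ eq)) refl

    -- One detecting phase is enough: earlier phases either hit, where acceptance is at most `α`, or
    -- hand over to it, and whatever follows it is reached with probability at most `β`.
    cheapFirst-≤ : ∀ h≤w? t {succ α w} → Sound M σ → 0ℚ ℚ.≤ α →
                   (∀ σ′ → Sound M σ′ → Pr accept (succ σ′) M ℚ.≤ α) →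
                   Detects w M (rowTrial σ) ⊎ Detects w M (colTrial σ) ⊎ Detects w M (entryTrial σ) →
                   Pr accept (cheapFirst σ h≤w? t succ) M ℚ.≤ α ℚ.+ (ℤ.+ w ℚ./ suc w) ^ℚ t
    cheapFirst-≤ h≤w? t {succ} {α} {w} snd 0≤α ih = detected h≤w?
      where
      β = (ℤ.+ w ℚ./ suc w) ^ℚ t
      α≤α+β : α ℚ.≤ α ℚ.+ β
      α≤α+β = ≤ℚ-respˡ (ℚ.+-identityʳ α) (ℚ.+-monoʳ-≤ α (^ℚ-nonNeg (0≤frac w) t))
      row = λ x σ′ eq → ih σ′ (proj₁ (row-grows snd x σ′ eq))
      col = λ x σ′ eq → ih σ′ (proj₁ (col-grows snd x σ′ eq))
      entry = λ x σ′ eq → ih σ′ (proj₁ (entry-grows snd x σ′ eq))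
      row′ = λ x σ′ eq → ℚ.≤-trans (row x σ′ eq) α≤α+β
      col′ = λ x σ′ eq → ℚ.≤-trans (col x σ′ eq) α≤α+β
      detected : ∀ h≤w? → Detects w M (rowTrial σ) ⊎ Detects w M (colTrial σ) ⊎ Detects w M (entryTrial σ) →
                 Pr accept (cheapFirst σ h≤w? t succ) M ℚ.≤ α ℚ.+ β
      detected (yes _) (inj₁ r)        = phase-≤ M (colTrial σ) t col′ (phase-detects M (rowTrial σ) w t 0≤α row r)
      detected (yes _) (inj₂ (inj₁ c)) = phase-detects M (colTrial σ) w t 0≤α col c
      detected (yes _) (inj₂ (inj₂ e)) =
        phase-≤ M (colTrial σ) t col′ (phase-≤ M (rowTrial σ) t row′ (phase-detects M (entryTrial σ) w t 0≤α entry e))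
      detected (no _)  (inj₁ r)        = phase-detects M (rowTrial σ) w t 0≤α row r
      detected (no _)  (inj₂ (inj₁ c)) = phase-≤ M (rowTrial σ) t row′ (phase-detects M (colTrial σ) w t 0≤α col c)
      detected (no _)  (inj₂ (inj₂ e)) =
        phase-≤ M (rowTrial σ) t row′ (phase-≤ M (colTrial σ) t col′ (phase-detects M (entryTrial σ) w t 0≤α entry e))

    module _ (S t : ℕ) where

      private
        p h w : ℕ
        p = area σ
        h = height σ
        w = width σ

      -- A potential. Each unit of area gained releases `2 * t` queries, and as long as the area is
      -- at most `S` a reserve of `5 * S * t` remains, enough for one full sweep without success.
      budget : ℕ → ℕ
      budget p = t * (7 * S ∸ 2 * p)

      -- One trial of each kind costs `h + w + 1 + w + h` in all, and none of the five terms exceeds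
      -- the area.
      within : ∀ c → p ≤ S → c ≤ h + w + suc (w + h) → c + 2 * p ≤ 7 * S
      within c p≤S c≤ = begin
        c + 2 * p                             ≤⟨ +-monoˡ-≤ (2 * p) c≤ ⟩
        h + w + suc (w + h) + 2 * p           ≤⟨ +-monoˡ-≤ (2 * p) (+-mono-≤ (+-mono-≤ h≤p w≤p)
                                                   (+-mono-≤ {1} (s≤s z≤n) (+-mono-≤ w≤p h≤p))) ⟩
        p + p + (p + (p + p)) + 2 * p         ≡⟨ solve 1 (λ p → p :+ p :+ (p :+ (p :+ p)) :+ con 2 :* p := con 7 :* p) refl p ⟩
        7 * p                                 ≤⟨ *-monoʳ-≤ 7 p≤S ⟩
        7 * S                                 ∎
        where
        open ≤-Reasoning
        open +-*-Solver
        h≤p : h ≤ p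
        h≤p = m≤m*n h w
        w≤p : w ≤ p
        w≤p = m≤n*m w h

      -- Enlarging the area by Δ frees a budget of 2 t Δ, which pays for the trials so far.
      pay : ∀ c Δ {p′ x} → p ≤ S → c ≤ 2 * Δ → c ≤ h + w + suc (w + h) →
            p′ ≡ Δ + p → x ≤ budget p′ → t * c + x ≤ budget p
      pay c Δ {x = x} p≤S c≤2Δ c≤ refl x≤ = begin
        t * c + x                                         ≤⟨ +-monoʳ-≤ (t * c) x≤ ⟩
        t * c + t * (K ∸ D)                               ≡⟨ *-distribˡ-+ t c (K ∸ D) ⟨
        t * (c + (K ∸ D))                                 ≤⟨ *-monoʳ-≤ t (m+n≤o⇒m≤o∸n _ freed) ⟩
        budget p                                          ∎
        where
        open ≤-Reasoning
        open +-*-Solver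
        K = 7 * S
        D = 2 * (Δ + p)
        freed : c + (K ∸ D) + 2 * p ≤ K
        freed with D ≤? K
        ... | yes D≤K = begin
          c + (K ∸ D) + 2 * p        ≡⟨ solve 3 (λ c x p → c :+ x :+ p := x :+ (c :+ p)) refl c (K ∸ D) (2 * p) ⟩
          K ∸ D + (c + 2 * p)        ≤⟨ +-monoʳ-≤ (K ∸ D) (+-monoˡ-≤ (2 * p) c≤2Δ) ⟩
          K ∸ D + (2 * Δ + 2 * p)    ≡⟨ cong (K ∸ D +_) (*-distribˡ-+ 2 Δ p) ⟨
          K ∸ D + D                  ≡⟨ m∸n+n≡m D≤K ⟩
          K                          ∎
        -- The area overshoots so far that the truncated budget afterwards is 0; the reserve pays.
        ... | no D≰K = begin
          c + (K ∸ D) + 2 * p        ≡⟨ cong (λ x → c + x + 2 * p) (m≤n⇒m∸n≡0 (≰⇒≥ D≰K)) ⟩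
          c + 0 + 2 * p              ≡⟨ cong (_+ 2 * p) (+-identityʳ c) ⟩
          c + 2 * p                  ≤⟨ within c p≤S c≤ ⟩
          K                          ∎

      finalPhase-queries : ∀ c {succ} → p ≤ S → c ≡ h + w → (∀ σ′ → queries (succ σ′) M ≤ budget (area σ′)) →
                           t * c + queries (finalPhase t σ succ) M ≤ budget p
      finalPhase-queries c {succ} p≤S refl ih = phase-queries M (entryTrial σ) t (t * c)
        (λ x σ′ eq → subst (λ e → e + queries (succ σ′) M ≤ budget p) (*-distribˡ-+ t c Δ)
          (pay (c + Δ) Δ p≤S c+Δ≤2Δ ≤-refl (entryTrial-area M σ x eq) (ih σ′)))
        (subst (_≤ budget p) (trans (*-distribˡ-+ t c Δ) (sym (+-identityʳ _)))
          (*-monoʳ-≤ t (m+n≤o⇒m≤o∸n (c + Δ) (within (c + Δ) p≤S ≤-refl))))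
        where
        Δ : ℕ
        Δ = suc (w + h)
        c+Δ≤2Δ : c + Δ ≤ 2 * Δ
        -- An entry hit gains more area than the row and column trials cost together.
        c+Δ≤2Δ = +-mono-≤ (≤-trans (≤-reflexive (+-comm h w)) (n≤1+n (w + h))) (≤-reflexive (sym (+-identityʳ Δ)))

      cheapFirst-queries : ∀ h≤w? {succ} → p ≤ S → (∀ σ′ → queries (succ σ′) M ≤ budget (area σ′)) →
                           queries (cheapFirst σ h≤w? t succ) M ≤ budget p
      cheapFirst-queries (yes h≤w) {succ} p≤S ih =
        phase-queries M (colTrial σ) t 0
          (λ x σ′ eq → pay h h p≤S (m≤n*m h 2) (≤-trans (m≤m+n h w) (m≤m+n (h + w) _))
            (colTrial-area M σ x eq) (ih σ′)) $
        phase-queries M (rowTrial σ) t (t * h)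
          (λ x σ′ eq → subst (λ e → e + queries (succ σ′) M ≤ budget p) (*-distribˡ-+ t h w)
            -- The gain `w` is at least half the cost `h + w`, because the cheaper trials came
            -- first.
            (pay (h + w) w p≤S (+-mono-≤ h≤w (≤-reflexive (sym (+-identityʳ w)))) (m≤m+n (h + w) _)
              (rowTrial-area M σ x eq) (ih σ′))) $
        subst (λ e → e + queries (finalPhase t σ succ) M ≤ budget p) (*-distribˡ-+ t h w)
          (finalPhase-queries (h + w) p≤S refl ih)
      cheapFirst-queries (no h≰w) {succ} p≤S ih =
        phase-queries M (rowTrial σ) t 0
          (λ x σ′ eq → pay w w p≤S (m≤n*m w 2) (≤-trans (m≤n+m w h) (m≤m+n (h + w) _))
            (rowTrial-area M σ x eq) (ih σ′)) $
        phase-queries M (colTrial σ) t (t * w)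
          (λ x σ′ eq → subst (λ e → e + queries (succ σ′) M ≤ budget p) (*-distribˡ-+ t w h)
            (pay (w + h) h p≤S (+-mono-≤ (≰⇒≥ h≰w) (≤-reflexive (sym (+-identityʳ h))))
              (≤-trans (≤-reflexive (+-comm w h)) (m≤m+n (h + w) _)) (colTrial-area M σ x eq) (ih σ′))) $
        subst (λ e → e + queries (finalPhase t σ succ) M ≤ budget p) (*-distribˡ-+ t w h)
          (finalPhase-queries (w + h) p≤S (+-comm w h) ih)

  module _ (s d t : ℕ) (M : Matrix n m) where

    probe-labelled : ∀ {σ} → Sound M σ → Labelled s M d → Labelled s (T σ) d
    probe-labelled {σ} snd ℓ =
      labelled-cong (λ p q → sym (agree snd p q)) (labelled-submatrix M (X σ) (Y σ) ℓ)

    run-accepts : Labelled s M d → ∀ fuel σ → Sound M σ → size s d < fuel + area σ →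
                  Pr accept (run s d t fuel σ) M ≡ 1ℚ
    -- Each success spends one unit of fuel and gains at least one of area, so without fuel the area
    -- would exceed Sgall's bound.
    run-accepts ℓ zero       σ snd size< = contradiction size<
      (≤⇒≯ (distinct⇒area≤size (T σ) (rows≢ snd) (cols≢ snd) (probe-labelled snd ℓ)))
    run-accepts ℓ (suc fuel) σ snd size< = trans
      (cong (λ A → Pr accept A M) (gate-yes ((area σ ≤? size s d) ×-dec labelled? s (T σ) d)
        (distinct⇒area≤size (T σ) (rows≢ snd) (cols≢ snd) ℓT , ℓT)))
      (cheapFirst-≡1 M σ (height σ ≤? width σ) t snd λ σ′ (snd′ , area<) →
        run-accepts ℓ fuel σ′ snd′ (<-≤-trans size<
          (≤-trans (≤-reflexive (sym (+-suc fuel (area σ)))) (+-monoʳ-≤ fuel area<))))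
      where
      ℓT : Labelled s (T σ) d
      ℓT = probe-labelled snd ℓ

    -- A union bound over at most `fuel` sweeps. A probe that passes the gate has rank at most `d`,
    -- hence so does its blow-up; the blow-up is therefore far from `M`, and some trial detects
    -- this.
    run-rejects : ∀ {w q} → suc w ≡ 3 * q → (∀ N → Labelled s N d → n * m < q * distance M N) →
                  ∀ fuel σ → Sound M σ →
                  Pr accept (run s d t fuel σ) M ℚ.≤ fromℕ fuel ℚ.* (ℤ.+ w ℚ./ suc w) ^ℚ t
    run-rejects {w} w≡ far zero       σ snd = ≤ℚ-respʳ (sym (ℚ.*-zeroˡ ((ℤ.+ w ℚ./ suc w) ^ℚ t))) ℚ.≤-refl
    run-rejects {w} {q} w≡ far (suc fuel) σ snd =
      gate-elim (λ A → Pr accept A M ℚ.≤ fromℕ (suc fuel) ℚ.* β) ((area σ ≤? size s d) ×-dec labelled? s (T σ) d)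
        (λ (_ , ℓ) → ≤ℚ-respʳ split (cheapFirst-≤ M σ (height σ ≤? width σ) t snd (0≤fβ fuel)
          (λ σ′ snd′ → run-rejects {w} {q} w≡ far fuel σ′ snd′)
          (far⇒detects snd {w} {q} w≡ (far (blowUp snd) (labelled-submatrix (T σ) _ _ ℓ)))))
        (0≤fβ (suc fuel))
      where
      β = (ℤ.+ w ℚ./ suc w) ^ℚ t
      0≤fβ : ∀ f → 0ℚ ℚ.≤ fromℕ f ℚ.* β
      0≤fβ f = ≤ℚ-respˡ (ℚ.*-zeroˡ β)
        (ℚ.*-monoʳ-≤-nonNeg β {{ℚ.nonNegative (^ℚ-nonNeg (0≤frac w) t)}} (0≤fromℕ f))
      split : fromℕ fuel ℚ.* β ℚ.+ β ≡ fromℕ (suc fuel) ℚ.* β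
      split = begin
        fromℕ fuel ℚ.* β ℚ.+ β               ≡⟨ cong (fromℕ fuel ℚ.* β ℚ.+_) (ℚ.*-identityˡ β) ⟨
        fromℕ fuel ℚ.* β ℚ.+ 1ℚ ℚ.* β        ≡⟨ ℚ.*-distribʳ-+ β (fromℕ fuel) 1ℚ ⟨
        (fromℕ fuel ℚ.+ 1ℚ) ℚ.* β            ≡⟨ cong (ℚ._* β) (fromℕ-+ fuel 1) ⟨
        fromℕ (fuel + 1) ℚ.* β               ≡⟨ cong (λ x → fromℕ x ℚ.* β) (+-comm fuel 1) ⟩
        fromℕ (suc fuel) ℚ.* β               ∎
        where open ≡-Reasoning

    run-queries : ∀ fuel σ → queries (run s d t fuel σ) M ≤ t * (7 * size s d ∸ 2 * area σ)
    run-queries zero       σ = z≤n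
    run-queries (suc fuel) σ =
      gate-elim (λ A → queries A M ≤ t * (7 * size s d ∸ 2 * area σ)) ((area σ ≤? size s d) ×-dec labelled? s (T σ) d)
        (λ (area≤ , _) → cheapFirst-queries M σ (size s d) t (height σ ≤? width σ) area≤ (run-queries fuel))
        z≤n

-- The testers

^-monoˡ-* : ∀ {x y z} t → x * y ≤ z → x ^ t * y ^ t ≤ z ^ t
^-monoˡ-* zero    xy≤z = ≤-refl
^-monoˡ-* {x} {y} {z} (suc t) xy≤z = begin
  x * x ^ t * (y * y ^ t)      ≡⟨ [m*n]*[o*p]≡[m*o]*[n*p] x (x ^ t) y (y ^ t) ⟩
  x * y * (x ^ t * y ^ t)      ≤⟨ *-mono-≤ xy≤z (^-monoˡ-* t xy≤z) ⟩
  z * z ^ t                    ∎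
  where open ≤-Reasoning

-- The first two terms of the binomial expansion of (1+w)^(1+j).
bernoulli : ∀ w j → w ^ suc j + suc j * w ^ j ≤ suc w ^ suc j
bernoulli w zero    = ≤-reflexive (solve 1 (λ w → w :* con 1 :+ con 1 := (con 1 :+ w) :* con 1) refl w)
  where open +-*-Solver
bernoulli w (suc j) = begin
  w * x + suc (suc j) * x              ≤⟨ m≤m+n _ (suc j * w ^ j) ⟩
  w * x + suc (suc j) * x + suc j * w ^ j
    ≡⟨ solve 3 (λ w j y → w :* (w :* y) :+ (con 2 :+ j) :* (w :* y) :+ (con 1 :+ j) :* y
         := (con 1 :+ w) :* (w :* y :+ (con 1 :+ j) :* y)) refl w j (w ^ j) ⟩
  suc w * (x + suc j * w ^ j)          ≤⟨ *-monoʳ-≤ (suc w) (bernoulli w j) ⟩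
  suc w ^ suc (suc j)                  ∎
  where
  open ≤-Reasoning
  open +-*-Solver
  x = w ^ suc j

-- So `1 + w` trials halve the probability of missing.
2w^[1+w]≤[1+w]^[1+w] : ∀ w → 2 * w ^ suc w ≤ suc w ^ suc w
2w^[1+w]≤[1+w]^[1+w] w = begin
  w ^ suc w + (w ^ suc w + 0)          ≡⟨ cong (w ^ suc w +_) (+-identityʳ _) ⟩
  w ^ suc w + w * w ^ w                ≤⟨ +-monoʳ-≤ (w ^ suc w) (m≤n+m (w * w ^ w) (w ^ w)) ⟩
  w ^ suc w + suc w * w ^ w            ≤⟨ bernoulli w w ⟩
  suc w ^ suc w                        ∎
  where open ≤-Reasoning

-- With `4 * d` halvings per sweep, the errors of `size s d` sweeps add up to at most one third.
-- Here 3 ≤ 2^(2d), and the two factors of `size` are at most 2^d each.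
3*size≤2^4d : ∀ s d → 1 ≤ d → 3 * size s d ≤ 2 ^ (4 * d)
3*size≤2^4d s d@(suc _) 1≤d = begin
  3 * (binom≤ d s * 2 ^ d)             ≤⟨ *-mono-≤ 3≤ (*-monoˡ-≤ (2 ^ d) (binom≤≤2^d d s)) ⟩
  2 ^ (2 * d) * (2 ^ d * 2 ^ d)        ≡⟨ cong (2 ^ (2 * d) *_) (^-distribˡ-+-* 2 d d) ⟨
  2 ^ (2 * d) * 2 ^ (d + d)            ≡⟨ ^-distribˡ-+-* 2 (2 * d) (d + d) ⟨
  2 ^ (2 * d + (d + d))                ≡⟨ cong (2 ^_) (solve 1 (λ d → con 2 :* d :+ (d :+ d) := con 4 :* d) refl d) ⟩
  2 ^ (4 * d)                          ∎
  where
  open ≤-Reasoning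
  open +-*-Solver
  3≤ : 3 ≤ 2 ^ (2 * d)
  3≤ = ≤-trans (n≤1+n 3) (^-monoʳ-≤ 2 (*-monoʳ-≤ 2 1≤d))

3*size*w^t≤[1+w]^t : ∀ s d w → 1 ≤ d → 3 * size s d * w ^ (suc w * (4 * d)) ≤ suc w ^ (suc w * (4 * d))
3*size*w^t≤[1+w]^t s d w 1≤d = begin
  3 * size s d * w ^ (suc w * (4 * d))       ≤⟨ *-mono-≤ (3*size≤2^4d s d 1≤d) (≤-reflexive (sym (^-*-assoc w (suc w) (4 * d)))) ⟩
  2 ^ (4 * d) * (w ^ suc w) ^ (4 * d)        ≤⟨ ^-monoˡ-* (4 * d) (2w^[1+w]≤[1+w]^[1+w] w) ⟩
  (suc w ^ suc w) ^ (4 * d)                  ≡⟨ ^-*-assoc (suc w) (suc w) (4 * d) ⟩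
  suc w ^ (suc w * (4 * d))                  ∎
  where open ≤-Reasoning

2^d≤size : ∀ s d → 2 ^ d ≤ size s d
2^d≤size s d = m≤n*m (2 ^ d) (binom≤ d s)

d≤2^d : ∀ d → d ≤ 2 ^ d
d≤2^d zero    = z≤n
d≤2^d (suc d) = ≤-trans (+-mono-≤ (m^n>0 2 d) (d≤2^d d)) (+-monoʳ-≤ (2 ^ d) (m≤m+n (2 ^ d) 0))

d≤size : ∀ s d → d ≤ size s d
d≤size s d = ≤-trans (d≤2^d d) (2^d≤size s d)

⅔≤1 : ℤ.+ 2 ℚ./ 3 ℚ.≤ 1ℚ
⅔≤1 = toWitness {a? = ℤ.+ 2 ℚ./ 3 ℚ.≤? 1ℚ} _

-- The hit probability is at least 1/(3q), so `3 * q` trials halve the error, and this is done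
-- `4 * d` times.
repetitions : (d q : ℕ) → ℕ
repetitions d q = 3 * q * (4 * d)

-- Testing for rank at most `d`

initial : Bool → Probe (suc n) (suc m)
initial v = probe {height-1 = 0} {width-1 = 0} (λ _ → zero) (λ _ → zero) (λ _ _ → v)

initial-sound : (M : Matrix (suc n) (suc m)) → Sound M (initial (M zero zero))
initial-sound M = record
  { agree = λ _ _ → refl
  ; rows≢ = λ { zero zero i≢ → contradiction refl i≢ }
  ; cols≢ = λ { zero zero i≢ → contradiction refl i≢ }
  }

atMostTester : (s d q n m : ℕ) → Algorithm n m
-- A matrix without entries has rank 0.
atMostTester s d q zero    m       = output accept
atMostTester s d q (suc n) zero    = output accept
atMostTester s d q (suc n) (suc m) = query zero zero λ v →
  run s d (repetitions d q) (size s d) (initial v)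

atMostTester-accepts : ∀ q (M : Matrix n m) → Labelled s M d → Pr accept (atMostTester s d q n m) M ≡ 1ℚ
atMostTester-accepts {zero}          q M ℓ = refl
atMostTester-accepts {suc n} {zero}  q M ℓ = refl
atMostTester-accepts {suc n} {suc m} {s} {d} q M ℓ =
  run-accepts s d (repetitions d q) M ℓ (size s d) (initial (M zero zero)) (initial-sound M)
    (m<m+n (size s d) (s≤s z≤n))

FarLabelled : ℕ → ℕ → ℕ → Matrix n m → Set
FarLabelled {n} {m} s d q M = ∀ N → Labelled s N d → n * m < q * distance M N

atMostTester-rejects : ∀ q (M : Matrix n m) → 1 ≤ d → 1 ≤ q → FarLabelled s d q M →
                       ℤ.+ 2 ℚ./ 3 ℚ.≤ Pr reject (atMostTester s d q n m) M
atMostTester-rejects {zero} q M 1≤d 1≤q far = contradiction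
  (far M ((λ ()) , (λ _ → Vec.replicate _ false) , λ ())) (subst (λ x → ¬ 0 < x) (sym (*-zeroʳ q)) λ ())
atMostTester-rejects {suc n} {zero} q M 1≤d 1≤q far = contradiction
  (far M ((λ _ → Vec.replicate _ false) , (λ ()) , λ _ ()))
  (subst₂ (λ x y → ¬ x < y) (sym (*-zeroʳ n))
    (sym (trans (cong (q *_) (distance-cong {M = M} {M} λ _ _ → refl)) (*-zeroʳ q))) λ ())
atMostTester-rejects {suc n} {suc m} {d} {s} q@(suc q′) M 1≤d 1≤q far =
  +≡1∧≤⅓⇒⅔≤ (Pr-complement (run s d t (size s d) σ) M) (ℚ.≤-trans
    (run-rejects s d t M {w} {q} w≡ far (size s d) σ (initial-sound M))
    (*frac-^≤⅓ (size s d) w t (3*size*w^t≤[1+w]^t s d w 1≤d)))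
  where
  -- Chosen so that `suc w` computes to `3 * q`.
  w = q′ + 2 * q
  t = repetitions d q
  σ = initial (M zero zero)
  w≡ : suc w ≡ 3 * q
  w≡ = refl

-- The constant is 3 · 4 from `repetitions` times 7 from the budget; the extra 1 is the query that
-- starts the probe.
atMostTester-queries : ∀ q (M : Matrix n m) → queries (atMostTester s d q n m) M ≤ 1 + 84 * (q * (d * size s d))
atMostTester-queries {zero}          q M = z≤n
atMostTester-queries {suc n} {zero}  q M = z≤n
atMostTester-queries {suc n} {suc m} {s} {d} q M = s≤s $ begin
  queries (run s d t (size s d) σ) M          ≤⟨ run-queries s d t M (size s d) σ ⟩
  t * (7 * size s d ∸ 2 * 1)                  ≤⟨ *-monoʳ-≤ t (m∸n≤m (7 * size s d) 2) ⟩
  t * (7 * size s d)                          ≡⟨ solve 3 (λ q d S →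
    con 3 :* q :* (con 4 :* d) :* (con 7 :* S) := con 84 :* (q :* (d :* S))) refl q d (size s d) ⟩
  84 * (q * (d * size s d))                   ∎
  where
  open ≤-Reasoning
  open +-*-Solver
  t = repetitions d q
  σ = initial (M zero zero)

-- Testing for rank exactly `1 + d`

exactly? : ∀ s (M : Matrix n m) d → Dec (Labelled s M (suc d) × ¬ Labelled s M d)
exactly? s M d = labelled? s M (suc d) ×-dec ¬? (labelled? s M d)

recall : Matrix n m → Matrix n m
recall {n} {m} M i j = answers M (remQuot {n} m) (combine i j)

readAll : (s d n m : ℕ) → Algorithm n m
readAll s d n m = queryAll (n * m) (remQuot m) λ r →
  gate (exactly? s (λ i j → r (combine {n} i j)) d) (output accept)

-- For large matrices an identity block costs too few changes to matter, so being far
-- from rank exactly 1 + d implies being far from rank at most 1 + d.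
bySize : ∀ s d q → Dec (n * m ≤ 2 * (q * (suc d * suc d))) → Algorithm n m
bySize {n} {m} s d q (yes _) = readAll s d n m
bySize {n} {m} s d q (no  _) = atMostTester s (suc d) (2 * q) n m

-- Rank `1 + d` takes at least `1 + d` rows and columns, so smaller matrices are rejected unread.
exactTester : (s d q n m : ℕ) → Algorithm n m
exactTester s d q n m =
  gate ((suc d ≤? n) ×-dec (suc d ≤? m)) (bySize s d q (n * m ≤? 2 * (q * (suc d * suc d))))

Pr-readAll : ∀ s d (M : Matrix n m) → Pr v (readAll s d n m) M ≡
            Pr v (gate (exactly? s (recall M) d) (output accept)) M
Pr-readAll {n} {m} s d M = Pr-queryAll (n * m) (remQuot m) _ M

recall-≗ : (M : Matrix n m) → M ≗₂ recall M
recall-≗ {n} {m} M i j = sym (trans (answers-lookup M (remQuot m) (combine i j))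
  (cong (uncurry M) (Finₚ.remQuot-combine {n} i j)))

exactTester-accepts : ∀ q (M : Matrix n m) → 1 ≤ s → BinaryRankExactly s (suc d) M →
                      Pr accept (exactTester s d q n m) M ≡ 1ℚ
exactTester-accepts {n} {m} {s} {d} q M 1≤s rank = trans
  (cong (λ A → Pr accept A M) (gate-yes ((suc d ≤? n) ×-dec (suc d ≤? m))
    (≮⇒≥ (λ { (s≤s n≤d) → ¬ℓ (labelled-mono M n≤d (labelled-rows 1≤s M)) }) , ≮⇒≥ (λ { (s≤s m≤d) → ¬ℓ (labelled-mono M m≤d (labelled-cols 1≤s M)) }))))
  (accepts (n * m ≤? 2 * (q * (suc d * suc d))))
  where
  ℓ : Labelled s M (suc d)
  ℓ = exactly⇒labelled M rank
  ¬ℓ : ¬ Labelled s M d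
  ¬ℓ = exactly⇒¬labelled M rank
  accepts : ∀ small? → Pr accept (bySize s d q small?) M ≡ 1ℚ
  accepts (no _)  = atMostTester-accepts (2 * q) M ℓ
  accepts (yes _) = trans (Pr-readAll s d M) (cong (λ A → Pr accept A M) (gate-yes (exactly? s (recall M) d)
    (labelled-cong (recall-≗ M) ℓ , ¬ℓ ∘ labelled-cong (λ i j → sym (recall-≗ M i j)))))

exactTester-rejects : ∀ q (M : Matrix n m) → 1 ≤ s → 1 ≤ q →
                      (∀ N → BinaryRankExactly s (suc d) N → n * m < q * distance M N) →
                      ℤ.+ 2 ℚ./ 3 ℚ.≤ Pr reject (exactTester s d q n m) M
exactTester-rejects {n} {m} {s} {d} q M 1≤s 1≤q far =
  gate-elim (λ A → ℤ.+ 2 ℚ./ 3 ℚ.≤ Pr reject A M) ((suc d ≤? n) ×-dec (suc d ≤? m))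
    (λ (D≤n , D≤m) → rejects D≤n D≤m (n * m ≤? 2 * (q * (suc d * suc d)))) ⅔≤1
  where
  D = suc d
  rejects : D ≤ n → D ≤ m → ∀ small? → ℤ.+ 2 ℚ./ 3 ℚ.≤ Pr reject (bySize s d q small?) M
  rejects D≤n D≤m (yes _) = ≤ℚ-respʳ (sym (Pr-readAll s d M))
    (gate-elim (λ A → ℤ.+ 2 ℚ./ 3 ℚ.≤ Pr reject A M) (exactly? s (recall M) d)
      (λ (ℓ , ¬ℓ) → contradiction
        (far M (labelled⇒exactly M (labelled-cong (λ i j → sym (recall-≗ M i j)) ℓ)
                                   (¬ℓ ∘ labelled-cong (recall-≗ M))))
        (subst (λ x → ¬ (n * m < x))
          (sym (trans (cong (q *_) (distance-cong {M = M} {M} λ _ _ → refl)) (*-zeroʳ q))) λ ()))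
      ⅔≤1)
  rejects D≤n D≤m (no large) = atMostTester-rejects (2 * q) M (s≤s z≤n) (≤-trans 1≤q (m≤m+n q _)) farther
    where
    open ≤-Reasoning
    open +-*-Solver
    farther : FarLabelled s D (2 * q) M
    farther N ℓ = let L , rank , close = exactly-nearby 1≤s D≤n D≤m N ℓ in
      -- The doubled inequality leaves one `n * m` to spare, which absorbs the cost
      -- `2 * (q * (D * D))` of passing from `N` to `L`.
      +-cancelʳ-< (n * m) (n * m) (2 * q * distance M N) $ begin-strict
      n * m + n * m                                        ≡⟨ cong (n * m +_) (+-identityʳ (n * m)) ⟨
      2 * (n * m)                                          <⟨ *-monoʳ-< 2 (far L rank) ⟩
      2 * (q * distance M L)                               ≤⟨ *-monoʳ-≤ 2 (*-monoʳ-≤ q (≤-trans (distance-triangle M N L) (+-monoʳ-≤ (distance M N) close))) ⟩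
      2 * (q * (distance M N + D * D))                     ≡⟨ solve 3 (λ q x y → con 2 :* (q :* (x :+ y)) := con 2 :* q :* x :+ con 2 :* (q :* y)) refl q (distance M N) (D * D) ⟩
      2 * q * distance M N + 2 * (q * (D * D))             ≤⟨ +-monoʳ-≤ (2 * q * distance M N) (≰⇒≥ large) ⟩
      2 * q * distance M N + n * m                         ∎

-- Here 169 = 1 + 84 · 2, since the inner tester runs with `2 * q`. A full read is cheaper still,
-- because `D ≤ size s D`.
exactTester-queries : ∀ q (M : Matrix n m) → 1 ≤ q →
                      queries (exactTester s d q n m) M ≤ 169 * (q * (suc d * size s (suc d)))
exactTester-queries {n} {m} {s} {d} q M 1≤q =
  gate-elim (λ A → queries A M ≤ 169 * x) ((suc d ≤? n) ×-dec (suc d ≤? m))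
    (λ _ → bounded (n * m ≤? 2 * (q * (D * D)))) z≤n
  where
  open ≤-Reasoning
  open +-*-Solver
  D = suc d
  x = q * (D * size s D)
  1≤x : 1 ≤ x
  1≤x = *-mono-≤ 1≤q (*-mono-≤ {1} {D} (s≤s z≤n) (≤-trans (s≤s z≤n) (d≤size s D)))
  bounded : ∀ small? → queries (bySize {n} {m} s d q small?) M ≤ 169 * x
  bounded (yes small) = begin
    queries (readAll s d n m) M     ≡⟨ queries-queryAll (n * m) (remQuot m) _ M ⟩
    n * m + queries (gate (exactly? s (recall M) d) (output accept)) M
      ≡⟨ cong (n * m +_) (gate-elim (λ A → queries A M ≡ 0) (exactly? s (recall M) d) (λ _ → refl) refl) ⟩
    n * m + 0                       ≡⟨ +-identityʳ (n * m) ⟩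
    n * m                           ≤⟨ small ⟩
    2 * (q * (D * D))               ≤⟨ *-mono-≤ {2} {169} (s≤s (s≤s z≤n)) (*-monoʳ-≤ q (*-monoʳ-≤ D (d≤size s D))) ⟩
    169 * x                         ∎
  bounded (no _) = begin
    queries (atMostTester s D (2 * q) n m) M     ≤⟨ atMostTester-queries {s = s} {D} (2 * q) M ⟩
    1 + 84 * (2 * q * (D * size s D))            ≤⟨ +-monoˡ-≤ _ 1≤x ⟩
    x + 84 * (2 * q * (D * size s D))            ≡⟨ solve 2 (λ q y → q :* y :+ con 84 :* (con 2 :* q :* y) := con 169 :* (q :* y)) refl q (D * size s D) ⟩
    169 * x                                      ∎

theorem1 : OneSidedTestable BinaryRankAtMost queryBound
    × OneSidedTestable BinaryRankExactly queryBound
    × queryBound ∈Õ sizeBound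
-- The constants are 2 · (1 + 84) and 2 · 169, the factor 2 coming from the rounding of 1/ε.
theorem1 = (170 , λ s d 1≤s 1≤d → T₁ s d , tester₁ s d 1≤d , one-sided₁ s d , bound₁ s d 1≤d)
         , (338 , exact)
         , (1 , 1 , λ s d 1≤s 1≤d ε ε<1 → ÷-mono-≤ ε (1 * logs s d ε ^ 1) (size s d)
             (*-monoˡ-≤ (size s d) (d≤logs s d ε)))
  where
  T₁ : (s d : ℕ) → TestingAlgorithm
  T₁ s d ε = atMostTester s d (recip ε)
  one-sided₁ : ∀ s d → IsOneSided (BinaryRankAtMost s d) (T₁ s d)
  one-sided₁ s d ε ε<1 n m M rank = atMostTester-accepts (recip ε) M (atMost⇒labelled M rank)
  tester₁ : ∀ s d → 1 ≤ d → IsTester (BinaryRankAtMost s d) (T₁ s d)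
  tester₁ s d 1≤d = record
    { accepts = λ ε ε<1 n m M rank → ≤ℚ-respʳ (sym (one-sided₁ s d ε ε<1 n m M rank)) ⅔≤1
    ; rejects = λ ε ε<1 n m M far → atMostTester-rejects (recip ε) M 1≤d (1≤recip ε)
        λ N ℓ → ε*<⇒<recip* ε (far N (labelled⇒atMost N ℓ))
    }
  bound₁ : ∀ s d → 1 ≤ d → ∀ ε .{{_ : Positive ε}} → ε ℚ.< 1ℚ → ∀ n m (M : Matrix n m) →
           fromℕ (queries (T₁ s d ε n m) M) ℚ.≤ fromℕ 170 ℚ.* queryBound s d ε
  bound₁ s d 1≤d ε ε<1 n m M = ℚ.≤-trans (fromℕ-mono-≤ (≤-trans (atMostTester-queries {s = s} {d} (recip ε) M)
    (+-monoˡ-≤ (84 * (recip ε * (d * size s d)))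
      (*-mono-≤ (1≤recip ε) (*-mono-≤ 1≤d (≤-trans 1≤d (d≤size s d)))))))
    (recip*-≤ ε ε<1 85 (d * size s d))
  exact : ∀ s d → 1 ≤ s → 1 ≤ d →
    ∃[ T ] (IsTester (BinaryRankExactly s d) T × IsOneSided (BinaryRankExactly s d) T ×
      (∀ ε .{{_ : Positive ε}} → ε ℚ.< 1ℚ → ∀ n m (M : Matrix n m) →
         fromℕ (queries (T ε n m) M) ℚ.≤ fromℕ 338 ℚ.* queryBound s d ε))
  exact s (suc d) 1≤s _ = T₂ , record
      { accepts = λ ε ε<1 n m M rank → ≤ℚ-respʳ (sym (one-sided₂ ε ε<1 n m M rank)) ⅔≤1
      ; rejects = λ ε ε<1 n m M far → exactTester-rejects (recip ε) M 1≤s (1≤recip ε)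
          λ N rank → ε*<⇒<recip* ε (far N rank)
      }
    , one-sided₂
    , λ ε ε<1 n m M → ℚ.≤-trans (fromℕ-mono-≤ (exactTester-queries {s = s} {d} (recip ε) M (1≤recip ε)))
        (recip*-≤ ε ε<1 169 (suc d * size s (suc d)))
    where
    T₂ : TestingAlgorithm
    T₂ ε = exactTester s d (recip ε)
    one-sided₂ : IsOneSided (BinaryRankExactly s (suc d)) T₂
    one-sided₂ ε ε<1 n m M = exactTester-accepts (recip ε) M 1≤s
  -- As 2^d ≤ `size s d`, a single logarithm absorbs the factor `d`.
  d≤logs : ∀ s d ε .{{_ : Positive ε}} → d ≤ 1 * logs s d ε ^ 1
  d≤logs s d ε = begin
    d                          ≡⟨ ⌈log₂2^n⌉≡n d ⟨
    ⌈log₂ 2 ^ d ⌉              ≤⟨ ⌈log₂⌉-mono-≤ (2^d≤size s d) ⟩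
    ⌈log₂ size s d ⌉           ≤⟨ m≤m+n _ _ ⟩
    logs s d ε                 ≡⟨ *-identityʳ (logs s d ε) ⟨
    logs s d ε ^ 1             ≡⟨ *-identityˡ (logs s d ε ^ 1) ⟨
    1 * logs s d ε ^ 1         ∎
    where open ≤-Reasoning
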